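{- Let $k$ be a fixed positive integer. For every integer $n \ge 1$, the randomized algorithm described in the context outputs a uniformly random $k$-coloured Motzkin path of length $n$, and its average (expected) complexity is linear in $n$, i.e. $O(n)$ as $n \to \infty$ with $k$ fixed.
   Context: Paths. A $k$-coloured Motzkin prefix of length $N$ is a lattice path starting at $(0,0)$, consisting of $N$ steps, each being a rise step $(1,1)$, a fall step $(1,-1)$, or a horizontal step $(1,0)$ carrying one of $k$ colours (so there are $k+2$ kinds of steps), and never going below the $x$-axis. Its final height is the ordinate of its last point. A $k$-coloured Motzkin path is a $k$-coloured Motzkin prefix with final height $0$. Cost model. Drawing a uniformly random element of the set of $k+2$ kinds of steps, and each elementary operation on a step or an integer, has unit cost. The transformation $\Gamma$. Let $P$ be a $k$-coloured Motzkin prefix of odd final height $2i+1$, $i \ge 0$. Write uniquely $P = P_1U_1P_2U_2\cdots P_{2i+1}U_{2i+1}P_{2i+2}$, where each $P_\ell$ is a (possibly empty) $k$-coloured Motzkin path (translated vertically) and each $U_\ell$ is a rise step (so $U_\ell$ is the last rise step of $P$ going from height $\ell-1$ to height $\ell$). Then $\Gamma(P)$ is the path obtained from $P$ by replacing the rise steps $U_1,\dots,U_{i+1}$ by fall steps; it ends at ordinate $-1$ and may go below the $x$-axis. The algorithm, on input $n$: (1) Generate a $k$-coloured Motzkin prefix $F$ of length $n+1$ by the anticipated rejection method (Florentine algorithm): starting from the empty path, repeatedly append a step drawn independently and uniformly from the $k+2$ kinds of steps; whenever the path goes below the $x$-axis, discard it entirely and restart from the empty path; stop when length $n+1$ is reached.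 (2) If $F$ has even final height, return to step (1). (3) Compute $\Gamma(F)$. (4) Encode rise, fall and horizontal steps by $1$, $-1$, $0$ respectively (steps keep their colours). Among the $n+1$ cyclic shifts (including the trivial one) of the step sequence of $\Gamma(F)$, find the unique one whose first $n$ partial sums are all non-negative (its total sum is $-1$, so its last step is a fall step). It is found in linear time by starting the cyclic shift immediately after the position at which the minimum of the partial sums of the encoding of $\Gamma(F)$ is first attained. Output the path formed by its first $n$ steps. -}

module Defs where

open import Data.Bool using (Bool; if_then_else_)
open import Data.Fin using (Fin)
import Data.Fin.Properties as Fin
open import Data.Integer using (ℤ; +_; 0ℤ; 1ℤ; -1ℤ)
import Data.Integer as ℤ
import Data.Integer.Properties as ℤ
open import Data.List using (List; []; _∷_; _++_; map; concatMap; filter; foldr; length; reverse; allFin)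
import Data.List.Properties as List
open import Data.List.Relation.Unary.All using (All; []; _∷_; all?)
open import Data.Maybe using (Maybe; just; nothing)
import Data.Maybe.Properties as Maybe
open import Data.Nat using (ℕ; zero; suc; _+_; _*_; _/_; _≥_; z≤n; s≤s)
open import Data.Nat.DivMod using (m*n/n≡m; +-distrib-/-∣ʳ)
open import Data.Nat.Divisibility using (divides)
import Data.Nat.Properties as ℕ
open import Data.Product using (∃-syntax; _×_; _,_)
open import Data.Rational using (ℚ; 0ℚ; 1ℚ)
import Data.Rational as ℚ
open import Data.Vec using (Vec; []; _∷_; replicate)
import Data.Vec as Vec
open import Data.Vec.Relation.Unary.All as VecAll using ([]; _∷_)
open import Relation.Binary.Definitions using (DecidableEquality)
open import Relation.Binary.PropositionalEquality
  using (_≡_; refl; sym; trans; cong; cong₂; subst)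
open import Relation.Nullary using (yes; no; does; contradiction; _×-dec_)
open import Relation.Unary using (Decidable)

data Step (k : ℕ) : Set where
  rise fall : Step k
  flat      : Fin k → Step k

Path : ℕ → Set
Path k = List (Step k)

encode : ∀ {k} → Step k → ℤ
encode rise     = 1ℤ
encode fall     = -1ℤ
encode (flat _) = 0ℤ

-- Ordinates of all points, the starting point (at ordinate h) included.
ordinates : ∀ {k} → ℤ → Path k → List ℤ
ordinates h []      = h ∷ []
ordinates h (s ∷ P) = h ∷ ordinates (h ℤ.+ encode s) P

finalHeight : ∀ {k} → Path k → ℤ
finalHeight []      = 0ℤ
finalHeight (s ∷ P) = encode s ℤ.+ finalHeight P

IsPrefix : ∀ {k} → Path k → Set
IsPrefix P = All (0ℤ ℤ.≤_) (ordinates 0ℤ P)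

IsMotzkin : ∀ {k} → Path k → Set
IsMotzkin P = IsPrefix P × finalHeight P ≡ 0ℤ

isMotzkin? : ∀ {k} → Decidable (IsMotzkin {k})
isMotzkin? P = all? (0ℤ ℤ.≤?_) (ordinates 0ℤ P) ×-dec (finalHeight P ℤ.≟ 0ℤ)

steps : ∀ k → List (Step k)
steps k = rise ∷ fall ∷ map flat (allFin k)

-- All step sequences of length n, each listed once.
words : ∀ k → ℕ → List (Path k)
words k zero    = [] ∷ []
words k (suc n) = concatMap (λ s → map (s ∷_) (words k n)) (steps k)

motzkinPaths : ∀ k → ℕ → List (Path k)
motzkinPaths k n = filter isMotzkin? (words k n)

_≟ˢ_ : ∀ {k} → DecidableEquality (Step k)
rise   ≟ˢ rise   = yes refl
rise   ≟ˢ fall   = no λ ()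
rise   ≟ˢ flat _ = no λ ()
fall   ≟ˢ rise   = no λ ()
fall   ≟ˢ fall   = yes refl
fall   ≟ˢ flat _ = no λ ()
flat _ ≟ˢ rise   = no λ ()
flat _ ≟ˢ fall   = no λ ()
flat c ≟ˢ flat d with c Fin.≟ d
... | yes refl = yes refl
... | no  c≢d  = no λ { refl → c≢d refl }

_≟ᴾ_ : ∀ {k} → DecidableEquality (Path k)
_≟ᴾ_ = List.≡-dec _≟ˢ_

-- `op p` performs one elementary operation and continues as p; `draw c` draws
-- a uniformly random step s and continues as c s.
data Prog (k : ℕ) (A : Set) : Set where
  ret  : A → Prog k A
  op   : Prog k A → Prog k A
  draw : (Step k → Prog k A) → Prog k A

infixl 1 _>>=_
_>>=_ : ∀ {k A B} → Prog k A → (A → Prog k B) → Prog k B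
ret a  >>= f = f a
op p   >>= f = op (p >>= f)
draw c >>= f = draw (λ s → c s >>= f)

-- ⟨ e ⟩ is the unit-cost evaluation of e, which must be a single operation
-- applied to values already at hand.
⟨_⟩ : ∀ {k A} → A → Prog k A
⟨ a ⟩ = op (ret a)

drawStep : ∀ {k} → Prog k (Step k)
drawStep = draw ret

mean : ∀ k → (Step k → ℚ) → ℚ
mean k f = (+ 1 ℚ./ (2 + k)) ℚ.* foldr ℚ._+_ 0ℚ (map f (steps k))

Pr : ∀ {k A} → Prog k A → (A → Bool) → ℚ
Pr (ret a)      E = if E a then 1ℚ else 0ℚ
Pr (op p)       E = Pr p E
Pr {k} (draw c) E = mean k (λ s → Pr (c s) E)

meanCost : ∀ {k A} → Prog k A → ℚ
meanCost (ret a)      = 0ℚ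
meanCost (op p)       = 1ℚ ℚ.+ meanCost p
meanCost {k} (draw c) = 1ℚ ℚ.+ mean k (λ s → meanCost (c s))

-- Unbounded restarting.  A program p : Prog k (Maybe A) is an attempt, which
-- either delivers an output or fails (`nothing`).  The randomised algorithm
-- "repeat p, with fresh draws, until it succeeds" is studied through its
-- truncations to at most m attempts.  As m grows, the events "the truncation
-- outputs w" increase to "the algorithm outputs w", and the cost of the
-- truncation increases to the cost of the algorithm.  So the output
-- probabilities are limits, and (monotone convergence) the expected cost is the
-- supremum, of those of the truncations.

orElse : ∀ {k A} → Maybe A → Prog k (Maybe A) → Prog k (Maybe A)
orElse (just a) q = ret (just a)
orElse nothing  q = op q

attempts : ∀ {k A} → ℕ → Prog k (Maybe A) → Prog k (Maybe A)
attempts zero    p = ret nothing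
attempts (suc m) p = p >>= λ r → orElse r (attempts m p)

_⟶_ : (ℕ → ℚ) → ℚ → Set
a ⟶ L = ∀ ε → 0ℚ ℚ.< ε → ∃[ N ] (∀ m → m ≥ N → ℚ.∣ a m ℚ.- L ∣ ℚ.< ε)

OutputProbability : ∀ {k} → Prog k (Maybe (Path k)) → Path k → ℚ → Set
OutputProbability p w q =
  (λ m → Pr (attempts m p) (λ r → does (Maybe.≡-dec _≟ᴾ_ r (just w)))) ⟶ q

ExpectedCost≤ : ∀ {k A} → Prog k (Maybe A) → ℚ → Set
ExpectedCost≤ p b = ∀ m → meanCost (attempts m p) ℚ.≤ b

reciprocal : ℕ → ℚ
reciprocal zero    = 0ℚ
reciprocal (suc m) = + 1 ℚ./ suc m

-- The mass function of the uniform distribution on k-coloured Motzkin paths of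
-- length n.  For k ≥ 1 there is at least one, so the dummy value
-- `reciprocal zero` is not used.
uniformMass : ∀ k → ℕ → Path k → ℚ
uniformMass k n w =
  if does (isMotzkin? w ×-dec (length w ℕ.≟ n))
  then reciprocal (length (motzkinPaths k n))
  else 0ℚ

UniformMotzkinOutput : ∀ k → ℕ → Prog k (Maybe (Path k)) → Set
UniformMotzkinOutput k n p = ∀ w → OutputProbability p w (uniformMass k n w)

-- Anticipated rejection, up to the first rejection.  The result is the prefix
-- with its LAST step first, together with its final height.

florentine : ∀ {k} → ℕ → Path k → ℤ → Prog k (Maybe (Path k × ℤ))
florentine zero    P h = op (ret (just (P , h)))
florentine (suc m) P h =
  op (drawStep               >>= λ s →
      ⟨ encode s ⟩           >>= λ v →
      ⟨ h ℤ.+ v ⟩            >>= λ h′ →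
      ⟨ does (h′ ℤ.<? 0ℤ) ⟩  >>= λ below →
      if below
      then ret nothing
      else (⟨ s ∷ P ⟩        >>= λ P′ →
            florentine m P′ h′))

-- Γ, the path being read backwards (argument: remaining steps, last one
-- first).  The current point has ordinate h, and ℓ is the index of the next U
-- to be met; U_ℓ is the first rise from ℓ-1 to ℓ met backwards after U_{ℓ+1}.
-- Each U_ℓ with ℓ ≤ t is replaced by a fall.  The result is in reading order.

scanΓ : ∀ {k} → ℤ → ℤ → ℤ → Path k → Path k → Prog k (Path k)
scanΓ t ℓ h []         acc = op (ret acc)
scanΓ t ℓ h (rise ∷ R) acc =
  op (⟨ does (h ℤ.≟ ℓ) ⟩     >>= λ isU →
      ⟨ h ℤ.- 1ℤ ⟩           >>= λ h′ →
      if isU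
      then (⟨ does (ℓ ℤ.≤? t) ⟩                      >>= λ low →
            ⟨ (if low then fall else rise) ⟩         >>= λ s →
            ⟨ s ∷ acc ⟩                              >>= λ acc′ →
            ⟨ ℓ ℤ.- 1ℤ ⟩                             >>= λ ℓ′ →
            scanΓ t ℓ′ h′ R acc′)
      else (⟨ rise ∷ acc ⟩                           >>= λ acc′ →
            scanΓ t ℓ h′ R acc′))
scanΓ t ℓ h (fall ∷ R) acc =
  op (⟨ h ℤ.+ 1ℤ ⟩           >>= λ h′ →
      ⟨ fall ∷ acc ⟩         >>= λ acc′ →
      scanΓ t ℓ h′ R acc′)
scanΓ t ℓ h (flat c ∷ R) acc =
  op (⟨ flat c ∷ acc ⟩       >>= λ acc′ →
      scanΓ t ℓ h R acc′)

-- Arguments: a prefix, last step first, and its final height h = 2i+1.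
gamma : ∀ {k} → Path k → ℤ → Prog k (Path k)
gamma R h =
  ⟨ h ℤ./ℕ 2 ⟩   >>= λ i →
  ⟨ i ℤ.+ 1ℤ ⟩   >>= λ t →
  scanΓ t h h R []

-- `gamma-correct` below: `gamma` computes Γ as defined through the decomposition
-- P₁ U₁ P₂ U₂ ⋯ U_{2i+1} P_{2i+2} into Motzkin paths and last rises.
-- p ⇓ a: the draw-free program p returns a.

infix 4 _⇓_
data _⇓_ {k A} : Prog k A → A → Set where
  ret⇓ : ∀ {a} → ret a ⇓ a
  op⇓  : ∀ {p a} → p ⇓ a → op p ⇓ a

-- P₁ u₁ P₂ u₂ ⋯ Pₘ uₘ Pₘ₊₁
interleave : ∀ {k m} → Vec (Path k) (suc m) → Vec (Step k) m → Path k
interleave (P ∷ [])          []       = P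
interleave (P ∷ Ps@(_ ∷ _))  (u ∷ us) = P ++ u ∷ interleave Ps us

private
  revˡ : ∀ {k} (s : Step k) P R → reverse (s ∷ P) ++ R ≡ reverse P ++ s ∷ R
  revˡ s P R = trans (cong (_++ R) (List.unfold-reverse s P))
                     (List.++-assoc (reverse P) (s ∷ []) R)

  head≤ : ∀ {k b h} (P : Path k) → All (b ℤ.≤_) (ordinates h P) → b ℤ.≤ h
  head≤ []      (x ∷ _) = x
  head≤ (_ ∷ _) (x ∷ _) = x

  +1-1 : ∀ h → h ℤ.+ 1ℤ ℤ.- 1ℤ ≡ h
  +1-1 h = trans (ℤ.+-assoc h 1ℤ -1ℤ) (ℤ.+-identityʳ h)

  -1+1 : ∀ h → h ℤ.+ -1ℤ ℤ.+ 1ℤ ≡ h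
  -1+1 h = trans (ℤ.+-assoc h -1ℤ 1ℤ) (ℤ.+-identityʳ h)

  suc≢ : ∀ {b h} → b ℤ.≤ h → h ℤ.+ 1ℤ ≡ b → ∀ {A : Set} → A
  suc≢ {b} {h} b≤h eq = contradiction
    (ℤ.<-≤-trans (ℤ.suc[i]≤j⇒i<j (ℤ.≤-reflexive (trans (ℤ.+-comm 1ℤ h) eq))) b≤h)
    (ℤ.<-irrefl refl)

  -- Reading backwards a segment staying at ordinate ≥ ℓ copies it.
  scan-segment : ∀ {k t ℓ h} (P : Path k) {R acc a} →
    All (ℓ ℤ.≤_) (ordinates h P) →
    scanΓ t ℓ h R (P ++ acc) ⇓ a →
    scanΓ t ℓ (h ℤ.+ finalHeight P) (reverse P ++ R) acc ⇓ a
  scan-segment {h = h} [] {R} {acc} {a} _ r =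
    subst (λ x → scanΓ _ _ x R acc ⇓ a) (sym (ℤ.+-identityʳ h)) r
  scan-segment {t = t} {ℓ} {h} (s ∷ P) {R} {acc} {a} (ℓ≤h ∷ ge) r =
    subst (λ X → scanΓ t ℓ (h ℤ.+ (encode s ℤ.+ finalHeight P)) X acc ⇓ a) (sym (revˡ s P R))
    (subst (λ x → scanΓ t ℓ x (reverse P ++ s ∷ R) acc ⇓ a)
      (ℤ.+-assoc h (encode s) (finalHeight P))
      (scan-segment P ge (one s r)))
    where
    one : ∀ s → scanΓ t ℓ h R (s ∷ P ++ acc) ⇓ a →
          scanΓ t ℓ (h ℤ.+ encode s) (s ∷ R) (P ++ acc) ⇓ a
    one rise r with h ℤ.+ 1ℤ ℤ.≟ ℓ
    ... | yes eq = suc≢ ℓ≤h eq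
    ... | no  _  = op⇓ (op⇓ (op⇓ (op⇓
      (subst (λ x → scanΓ t ℓ x R (rise ∷ P ++ acc) ⇓ a) (sym (+1-1 h)) r))))
    one fall r = op⇓ (op⇓ (op⇓
      (subst (λ x → scanΓ t ℓ x R (fall ∷ P ++ acc) ⇓ a) (sym (-1+1 h)) r)))
    one (flat c) r = op⇓ (op⇓
      (subst (λ x → scanΓ t ℓ x R (flat c ∷ P ++ acc) ⇓ a) (sym (ℤ.+-identityʳ h)) r))

  shift-ordinates : ∀ {k b h} d (P : Path k) → All (b ℤ.≤_) (ordinates h P) →
    All (d ℤ.+ b ℤ.≤_) (ordinates (d ℤ.+ h) P)
  shift-ordinates d []      (x ∷ []) = ℤ.+-monoʳ-≤ d x ∷ []
  shift-ordinates {h = h} d (s ∷ P) (x ∷ xs) = ℤ.+-monoʳ-≤ d x ∷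
    subst (λ y → All _ (ordinates y P)) (sym (ℤ.+-assoc d h (encode s)))
      (shift-ordinates d P xs)

  scan-motzkin : ∀ {k t ℓ} (P : Path k) {R acc a} → IsMotzkin P →
    scanΓ t ℓ ℓ R (P ++ acc) ⇓ a → scanΓ t ℓ ℓ (reverse P ++ R) acc ⇓ a
  scan-motzkin {t = t} {ℓ} P {R} {acc} {a} (ge , eq) r =
    subst (λ x → scanΓ t ℓ x (reverse P ++ R) acc ⇓ a)
      (trans (cong (λ x → ℓ ℤ.+ x) eq) (ℤ.+-identityʳ ℓ))
      (scan-segment P
        (subst (λ y → All (ℓ ℤ.≤_) (ordinates y P)) (ℤ.+-identityʳ ℓ)
          (subst (λ b → All (b ℤ.≤_) (ordinates (ℓ ℤ.+ 0ℤ) P)) (ℤ.+-identityʳ ℓ)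
            (shift-ordinates ℓ P ge)))
        r)

  mark : ∀ {k} → ℤ → ℤ → Step k
  mark t ℓ = if does (ℓ ℤ.≤? t) then fall else rise

  marks : ∀ {k} → ℤ → ℤ → ∀ m → Vec (Step k) m
  marks t j zero    = []
  marks t j (suc m) = mark t (j ℤ.+ 1ℤ) ∷ marks t (j ℤ.+ 1ℤ) m

  rev-middle : ∀ {k} (P : Path k) s Q R →
    reverse (P ++ s ∷ Q) ++ R ≡ reverse Q ++ s ∷ reverse P ++ R
  rev-middle P s Q R =
    trans (cong (_++ R) (List.reverse-++ P (s ∷ Q)))
      (trans (List.++-assoc (reverse (s ∷ Q)) (reverse P) R)
             (revˡ s Q (reverse P ++ R)))

  scan-interleave : ∀ {k t} m j (Ps : Vec (Path k) (suc m)) {R acc a} →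
    VecAll.All IsMotzkin Ps →
    scanΓ t j j R (interleave Ps (marks t j m) ++ acc) ⇓ a →
    scanΓ t (j ℤ.+ + m) (j ℤ.+ + m) (reverse (interleave Ps (replicate m rise)) ++ R) acc ⇓ a
  scan-interleave {t = t} zero j (P ∷ []) {R} {acc} {a} (mP ∷ []) r =
    subst (λ x → scanΓ t x x (reverse P ++ R) acc ⇓ a) (sym (ℤ.+-identityʳ j))
      (scan-motzkin P mP r)
  scan-interleave {t = t} (suc m) j (P ∷ Ps@(_ ∷ _)) {R} {acc} {a} (mP ∷ mPs) r =
    subst (λ X → scanΓ t (j ℤ.+ + suc m) (j ℤ.+ + suc m) X acc ⇓ a)
      (sym (rev-middle P rise (interleave Ps (replicate m rise)) R))
    (subst (λ x → scanΓ t x x (reverse (interleave Ps (replicate m rise)) ++ rise ∷ reverse P ++ R) acc ⇓ a)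
      (ℤ.+-assoc j 1ℤ (+ m))
      (scan-interleave m (j ℤ.+ 1ℤ) Ps mPs crossing))
    where
    rest : Path _
    rest = interleave Ps (marks t (j ℤ.+ 1ℤ) m) ++ acc
    crossing : scanΓ t (j ℤ.+ 1ℤ) (j ℤ.+ 1ℤ) (rise ∷ reverse P ++ R) rest ⇓ a
    crossing with j ℤ.+ 1ℤ ℤ.≟ j ℤ.+ 1ℤ
    ... | no  ≢ = contradiction refl ≢
    ... | yes _ = op⇓ (op⇓ (op⇓ (op⇓ (op⇓ (op⇓ (op⇓
      (subst (λ x → scanΓ t x x (reverse P ++ R) (mark t (j ℤ.+ 1ℤ) ∷ rest) ⇓ a)
        (sym (+1-1 j))
        (scan-motzkin P mP
          (subst (λ X → scanΓ t j j R X ⇓ a)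
            (List.++-assoc P (mark t (j ℤ.+ 1ℤ) ∷ interleave Ps (marks t (j ℤ.+ 1ℤ) m)) acc)
            r)))))))))

  mark-low : ∀ {k t ℓ} → ℓ ℤ.≤ t → mark {k} t ℓ ≡ fall
  mark-low {t = t} {ℓ} le with ℓ ℤ.≤? t
  ... | yes _ = refl
  ... | no  ¬ = contradiction le ¬

  mark-high : ∀ {k t ℓ} → t ℤ.< ℓ → mark {k} t ℓ ≡ rise
  mark-high {t = t} {ℓ} lt with ℓ ℤ.≤? t
  ... | no  _  = refl
  ... | yes le = contradiction le (ℤ.<⇒≱ lt)

  marks-high : ∀ {k t j} m → t ℤ.≤ j → marks {k} t j m ≡ replicate m rise
  marks-high zero    le = refl
  marks-high {t = t} {j} (suc m) le = cong₂ _∷_ (mark-high lt) (marks-high m (ℤ.<⇒≤ lt))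
    where
    lt : t ℤ.< j ℤ.+ 1ℤ
    lt = ℤ.≤-<-trans le (ℤ.suc[i]≤j⇒i<j (ℤ.≤-reflexive (ℤ.+-comm 1ℤ j)))

  marks-low : ∀ {k} n j m → marks {k} (j ℤ.+ + n) j (n + m) ≡ replicate n fall Vec.++ replicate m rise
  marks-low zero    j m = marks-high m (ℤ.≤-reflexive (ℤ.+-identityʳ j))
  marks-low (suc n) j m = cong₂ _∷_
    (mark-low (ℤ.+-monoʳ-≤ j (ℤ.+≤+ (s≤s z≤n))))
    (trans (cong (λ x → marks x (j ℤ.+ 1ℤ) (n + m)) (sym (ℤ.+-assoc j 1ℤ (+ n))))
      (marks-low n (j ℤ.+ 1ℤ) m))

  half : ∀ i → (suc i + i) / 2 ≡ i
  half i = trans (cong (λ x → suc x / 2) (trans (cong (λ y → i + y) (sym (ℕ.+-identityʳ i))) (ℕ.*-comm 2 i)))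
    (trans (+-distrib-/-∣ʳ 1 {i * 2} {2} (divides i refl)) (m*n/n≡m i 2))

gamma-correct : ∀ {k} i (Ps : Vec (Path k) (suc (suc i + i))) → VecAll.All IsMotzkin Ps →
  gamma (reverse (interleave Ps (replicate (suc i + i) rise))) (+ (suc i + i))
    ⇓ interleave Ps (replicate (suc i) fall Vec.++ replicate i rise)
gamma-correct {k} i Ps mPs = op⇓ (op⇓ (subst (λ x → scanΓ x h h X [] ⇓ Y) (sym t≡) main))
  where
  h = + (suc i + i)
  X = reverse (interleave Ps (replicate (suc i + i) rise))
  Y = interleave Ps (replicate (suc i) fall Vec.++ replicate i rise)
  t≡ : h ℤ./ℕ 2 ℤ.+ 1ℤ ≡ 0ℤ ℤ.+ + suc i
  t≡ = cong +_ (trans (cong (_+ 1) (half i)) (ℕ.+-comm i 1))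
  main : scanΓ (0ℤ ℤ.+ + suc i) h h X [] ⇓ Y
  main = subst (λ Z → scanΓ (0ℤ ℤ.+ + suc i) h h Z [] ⇓ Y) (List.++-identityʳ X)
    (scan-interleave (suc i + i) 0ℤ Ps mPs
      (subst (λ Z → scanΓ (0ℤ ℤ.+ + suc i) 0ℤ 0ℤ [] Z ⇓ Y)
        (sym (trans (List.++-identityʳ _) (cong (interleave Ps) (marks-low (suc i) 0ℤ i))))
        (op⇓ ret⇓)))

-- p: number of steps read, S: their sum, μ: least partial sum so far, q: the
-- position where it is first attained.
firstMin : ∀ {k} → ℕ → ℤ → ℤ → ℕ → Path k → Prog k ℕ
firstMin p S μ q []      = op (ret q)
firstMin p S μ q (s ∷ P) =
  op (⟨ encode s ⟩           >>= λ v →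
      ⟨ S ℤ.+ v ⟩            >>= λ S′ →
      ⟨ suc p ⟩              >>= λ p′ →
      ⟨ does (S′ ℤ.<? μ) ⟩   >>= λ less →
      if less then firstMin p′ S′ S′ p′ P else firstMin p′ S′ μ q P)

takeᵖ : ∀ {k} → ℕ → Path k → Prog k (Path k)
takeᵖ zero    P       = op (ret [])
takeᵖ (suc m) []      = op (ret [])
takeᵖ (suc m) (s ∷ P) = op (takeᵖ m P >>= λ Q → ⟨ s ∷ Q ⟩)

dropᵖ : ∀ {k} → ℕ → Path k → Prog k (Path k)
dropᵖ zero    P       = op (ret P)
dropᵖ (suc m) []      = op (ret [])
dropᵖ (suc m) (s ∷ P) = op (dropᵖ m P)

appendᵖ : ∀ {k} → Path k → Path k → Prog k (Path k)
appendᵖ []      Q = op (ret Q)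
appendᵖ (s ∷ P) Q = op (appendᵖ P Q >>= λ P′ → ⟨ s ∷ P′ ⟩)

-- The partial sums start here with the empty one, 0.  As the total is -1, it is
-- never the minimum, so it does not affect the position found.
shift : ∀ {k} → ℕ → Path k → Prog k (Path k)
shift n G =
  firstMin 0 0ℤ 0ℤ 0 G   >>= λ q →
  dropᵖ q G              >>= λ A →
  takeᵖ q G              >>= λ B →
  appendᵖ A B            >>= λ W →
  takeᵖ n W

fromPrefix : ∀ {k} → ℕ → Maybe (Path k × ℤ) → Prog k (Maybe (Path k))
fromPrefix n nothing        = ret nothing
fromPrefix n (just (R , h)) =
  ⟨ h ℤ.%ℕ 2 ⟩         >>= λ r →
  ⟨ does (r ℕ.≟ 0) ⟩   >>= λ even →
  if even
  then ret nothing
  else (gamma R h      >>= λ G →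
        shift n G      >>= λ w →
        ret (just w))

-- One pass of the algorithm.  Going below the axis and an even final height both
-- cause a restart from the empty path, so the whole algorithm repeats this pass
-- until it succeeds.
motzkinAttempt : ∀ k → ℕ → Prog k (Maybe (Path k))
motzkinAttempt k n = florentine (suc n) [] 0ℤ >>= fromPrefix n

{-# OPTIONS --safe #-}
module Submission where

-- Cutting an odd prefix at its last rise from height i to height i + 1 writes it
-- as X U A with X and A prefixes of final height i.  Turning the last rises of X
-- into falls makes X a path from height i down to 0, and the algorithm outputs A
-- followed by this path.  The turning is reversible, so a Motzkin path of length
-- n is the output of exactly n + 1 odd prefixes, one for each position at which
-- it can be cut; hence uniformity.
--
-- Let A_n, O_n, E_n, M_n count the prefixes of length n, those of odd height, of
-- even height and of height 0, and let K = k + 2.  Then A_{n+1} + M_n = K A_n and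
-- O_{n+1} + M_n = k O_n + 2 E_n, while O_{n+1} = (n + 1) M_n by the above.  So
-- (n + 2) M_n ≤ (k + 1) A_n, and the survival probabilities a_n = A_n / K^n satisfy
-- a_{n+1} ≥ (1 - (k + 1) / (K (n + 2))) a_n.  Since (k + 1) / K < 1, this gives
-- a_0 + ⋯ + a_n ≤ K (n + 1) a_n by induction, and A_n ≤ 2 O_{n+1} bounds the
-- right-hand side by O(n) times the success probability of a pass.

-- The success probability of a pass decays with n, so a linear total needs the expected length of a
-- pass weighed against that decaying probability. No asymptotics of Motzkin numbers enter: the
-- correspondence that gives uniformity also supplies the one quantitative fact, O_{n+1} = (n + 1)
-- M_n. Only prefixes ending at height 0 can be rejected by the next step, and this identity makes
-- them a fraction of at most (k + 1) / (n + 2) of the survivors.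
--
-- The constant k + 1 replaces the larger coefficient of k O_n + 2 E_n, which is allowed because k ≥
-- 1. Being K - 1, it leaves just the room that the induction on a_0 + ⋯ + a_n requires.
--
-- All estimates are inequalities between counts in ℕ, scaled by powers of K, with subtracted terms
-- moved to the other side; rationals enter only through the factor K^-n.

open import Defs
open import Algebra.Bundles using (CommutativeMonoid)
open import Data.Bool using (Bool; true; false; if_then_else_)
open import Data.Integer using (ℤ; +_; -[1+_]; 0ℤ; 1ℤ; -1ℤ)
import Data.Integer as ℤ
import Data.Integer.Properties as ℤ
open import Data.List using (List; []; _∷_; _++_; _ʳ++_; allFin; applyUpTo; cartesianProductWith;
  concatMap; drop; filter; foldr; length; map; reverse; take)
open import Data.List.Membership.Propositional using (_∈_)
open import Data.List.Membership.Propositional.Properties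
  using (∈-allFin; ∈-applyUpTo⁺; ∈-applyUpTo⁻; ∈-cartesianProductWith⁺; ∈-cartesianProductWith⁻;
         ∈-filter⁺; ∈-filter⁻; ∈-map⁺; ∈-map⁻)
open import Data.List.Membership.Propositional.Properties.WithK using (unique∧set⇒bag)
import Data.List.Properties as List
open import Data.List.Relation.Binary.BagAndSetEquality using (∼bag⇒↭)
open import Data.List.Relation.Binary.Permutation.Propositional.Properties using (↭-length)
open import Data.List.Relation.Unary.All using (All; []; _∷_)
import Data.List.Relation.Unary.All as All
import Data.List.Relation.Unary.All.Properties as All
open import Data.List.Relation.Unary.AllPairs using ([]; _∷_)
open import Data.List.Relation.Unary.Any using (here; there)
open import Data.List.Relation.Unary.Unique.Propositional using (Unique)
import Data.List.Relation.Unary.Unique.Propositional.Properties as Unique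
open import Data.Maybe using (Maybe; just; nothing)
import Data.Maybe.Properties as Maybe
open import Data.Nat using (ℕ; zero; suc; _+_; _*_; _^_; _≤_; z≤n; s≤s; _%_)
import Data.Nat as ℕ
import Data.Nat.Coprimality as Coprimality
open import Data.Nat.Divisibility using (divides)
open import Data.Nat.DivMod using (m*n/n≡m; +-distrib-/-∣ʳ; [m+kn]%n≡m%n)
import Data.Nat.Properties as ℕ
open import Data.Nat.Tactic.RingSolver using (solve-∀)
open import Data.Product using (∃; ∃₂; ∃-syntax; _×_; _,_; proj₁; proj₂)
open import Data.Rational using (ℚ; 0ℚ; 1ℚ; mkℚ; _/_)
import Data.Rational as ℚ
import Data.Rational.Properties as ℚ
open import Data.Rational.Solver using (module +-*-Solver)
import Data.Rational.Unnormalised as ℚᵘ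
import Data.Rational.Unnormalised.Properties as ℚᵘ
open import Data.Sum using (_⊎_; inj₁; inj₂)
open import Function using (_∘_; mk⇔)
open import Level using (0ℓ)
open import Relation.Binary.PropositionalEquality
  using (_≡_; _≢_; refl; sym; trans; cong; cong₂; subst; subst₂; module ≡-Reasoning)
open import Relation.Nullary using (Dec; yes; no; does; ¬_; contradiction; _×-dec_)
open import Relation.Nullary.Decidable using (dec-true; dec-false)
open import Relation.Unary using (Decidable)

-- Decomposition of prefixes

take-length-++ : ∀ {A : Set} (xs ys : List A) → take (length xs) (xs ++ ys) ≡ xs
take-length-++ []       ys = refl
take-length-++ (x ∷ xs) ys = cong (x ∷_) (take-length-++ xs ys)

drop-length-++ : ∀ {A : Set} (xs ys : List A) → drop (length xs) (xs ++ ys) ≡ ys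
drop-length-++ []       ys = refl
drop-length-++ (x ∷ xs) ys = drop-length-++ xs ys

-- R, read backwards, is a prefix of final height h.
data Up {k} : Path k → ℕ → Set where
  []   : Up [] 0
  rise : ∀ {R h} → Up R h → Up (rise ∷ R) (suc h)
  fall : ∀ {R h} → Up R (suc h) → Up (fall ∷ R) h
  flat : ∀ {R h c} → Up R h → Up (flat c ∷ R) h

-- Natural-number heights make a path below the axis unrepresentable, here in reading order and
-- ending at height 0. A shared index expresses that the two pieces at a cut meet at the same
-- height.
data Down {k} : Path k → ℕ → Set where
  []   : Down [] 0
  rise : ∀ {P h} → Down P (suc h) → Down (rise ∷ P) h
  fall : ∀ {P h} → Down P h → Down (fall ∷ P) (suc h)
  flat : ∀ {P h c} → Down P h → Down (flat c ∷ P) h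

Up-unique : ∀ {k} {R : Path k} {h h′} → Up R h → Up R h′ → h ≡ h′
Up-unique []       []        = refl
Up-unique (rise u) (rise u′) = cong suc (Up-unique u u′)
Up-unique (fall u) (fall u′) = ℕ.suc-injective (Up-unique u u′)
Up-unique (flat u) (flat u′) = Up-unique u u′

Up-ʳ++ : ∀ {k} {R : Path k} {P h} → Up R h → Down P h → Down (R ʳ++ P) 0
Up-ʳ++ []       d = d
Up-ʳ++ (rise u) d = Up-ʳ++ u (rise d)
Up-ʳ++ (fall u) d = Up-ʳ++ u (fall d)
Up-ʳ++ (flat u) d = Up-ʳ++ u (flat d)

Down-split : ∀ {k} {P : Path k} {R h} → Up R h → Down P h → ∀ j →
  ∃[ i ] Up (take j P ʳ++ R) i × Down (drop j P) i
Down-split u d        zero    = _ , u , d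
Down-split u []       (suc j) = _ , u , []
Down-split u (rise d) (suc j) = Down-split (rise u) d j
Down-split u (fall d) (suc j) = Down-split (fall u) d j
Down-split u (flat d) (suc j) = Down-split (flat u) d j

Up-++ : ∀ {k} {R S : Path k} {a b} → Up R b → Up S a → Up (R ++ S) (b + a)
Up-++ []       v = v
Up-++ (rise u) v = rise (Up-++ u v)
Up-++ (fall u) v = fall (Up-++ u v)
Up-++ (flat u) v = flat (Up-++ u v)

-- Reads a prefix backwards, its last step first, and turns every last rise from
-- one level to the next into a fall.  d is the current height minus the least
-- height met so far, so a rise read at d = 0 is a last rise.
flip : ∀ {k} → ℕ → Path k → Path k → Path k
flip d       []           P = P
flip d       (fall ∷ R)   P = flip (suc d) R (fall ∷ P)
flip d       (flat c ∷ R) P = flip d R (flat c ∷ P)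
flip zero    (rise ∷ R)   P = flip zero R (fall ∷ P)
flip (suc d) (rise ∷ R)   P = flip d R (rise ∷ P)

-- Each clause undoes one clause of `flip`, moving a step back between the two paths. Here too d is
-- the height minus the least height so far: a `fall` at d = 0 reaches a new minimum, so it stems
-- from a last rise.
unflip : ∀ {k} → ℕ → Path k → Path k → Path k
unflip d       []           R = R
unflip d       (rise ∷ P)   R = unflip (suc d) P (rise ∷ R)
unflip d       (flat c ∷ P) R = unflip d P (flat c ∷ R)
unflip zero    (fall ∷ P)   R = unflip zero P (rise ∷ R)
unflip (suc d) (fall ∷ P)   R = unflip d P (fall ∷ R)

private
  castUp : ∀ {k} {R : Path k} {m n} → m ≡ n → Up R m → Up R n
  castUp eq = subst (Up _) eq
  castDown : ∀ {k} {P : Path k} {m n} → m ≡ n → Down P m → Down P n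
  castDown eq = subst (Down _) eq

-- Invariant: the unread part ends at height ℓ + d, where ℓ is the least height met, and the
-- rewritten part starts at e + d. Turning a last rise moves one unit from ℓ to e, so e + ℓ is
-- constant, and once everything is read ℓ = d = 0.
flip-Down : ∀ {k} ℓ {e} d {R P : Path k} →
  Up R (ℓ + d) → Down P (e + d) → Down (flip d R P) (e + ℓ)
flip-Down zero    zero    []       v = v
flip-Down (suc ℓ) {e} zero (rise u) v =
  castDown (sym (ℕ.+-suc e ℓ)) (flip-Down ℓ {suc e} zero u (fall v))
flip-Down ℓ {e} (suc d) {rise ∷ R} u v with castUp (ℕ.+-suc ℓ d) u
... | rise u′ = flip-Down ℓ {e} d u′ (rise (castDown (ℕ.+-suc e d) v))
flip-Down ℓ {e} d (fall u) v =
  flip-Down ℓ (suc d) (castUp (sym (ℕ.+-suc ℓ d)) u) (castDown (sym (ℕ.+-suc e d)) (fall v))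
flip-Down ℓ     d (flat u) v = flip-Down ℓ d u (flat v)

unflip-Up : ∀ {k} ℓ {e} d {R P : Path k} →
  Up R (ℓ + d) → Down P (e + d) → Up (unflip d P R) (ℓ + e)
unflip-Up ℓ {zero} zero u [] = u
unflip-Up ℓ {suc e} zero u (fall v) =
  castUp (sym (ℕ.+-suc ℓ e)) (unflip-Up (suc ℓ) {e} zero (rise u) v)
unflip-Up ℓ {e} (suc d) {P = fall ∷ P} u v with castDown (ℕ.+-suc e d) v
... | fall v′ = unflip-Up ℓ {e} d (fall (castUp (ℕ.+-suc ℓ d) u)) v′
unflip-Up ℓ {e} d u (rise v) =
  unflip-Up ℓ (suc d) (castUp (sym (ℕ.+-suc ℓ d)) (rise u)) (castDown (sym (ℕ.+-suc e d)) v)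
unflip-Up ℓ     d u (flat v) = unflip-Up ℓ d (flat u) v

-- Run from the result, `unflip` passes through all intermediate pairs of the `flip` run in reverse.
-- The height index guarantees that `flip` stops with d = 0, the value from which `unflip` starts.
unflip-flip : ∀ {k} ℓ d (R P : Path k) → Up R (ℓ + d) →
  unflip 0 (flip d R P) [] ≡ unflip d P R
unflip-flip zero    zero    []           P u        = refl
unflip-flip (suc ℓ) zero    (rise ∷ R)   P (rise u) = unflip-flip ℓ zero R (fall ∷ P) u
unflip-flip ℓ       (suc d) (rise ∷ R)   P u with castUp (ℕ.+-suc ℓ d) u
... | rise u′ = unflip-flip ℓ d R (rise ∷ P) u′
unflip-flip ℓ       d       (fall ∷ R)   P (fall u) =
  unflip-flip ℓ (suc d) R (fall ∷ P) (castUp (sym (ℕ.+-suc ℓ d)) u)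
unflip-flip ℓ       d       (flat c ∷ R) P (flat u) = unflip-flip ℓ d R (flat c ∷ P) u

flip-unflip : ∀ {k} e d (P R : Path k) → Down P (e + d) →
  flip 0 (unflip d P R) [] ≡ flip d R P
flip-unflip zero    zero    []           R v        = refl
flip-unflip (suc e) zero    (fall ∷ P)   R (fall v) = flip-unflip e zero P (rise ∷ R) v
flip-unflip e       (suc d) (fall ∷ P)   R v with castDown (ℕ.+-suc e d) v
... | fall v′ = flip-unflip e d P (fall ∷ R) v′
flip-unflip e       d       (rise ∷ P)   R (rise v) =
  flip-unflip e (suc d) P (rise ∷ R) (castDown (sym (ℕ.+-suc e d)) v)
flip-unflip e       d       (flat c ∷ P) R (flat v) = flip-unflip e d P (flat c ∷ R) v

length-flip : ∀ {k} d (R P : Path k) → length (flip d R P) ≡ length R + length P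
length-flip d       []           P = refl
length-flip zero    (rise ∷ R)   P = trans (length-flip zero R (fall ∷ P)) (ℕ.+-suc _ _)
length-flip (suc d) (rise ∷ R)   P = trans (length-flip d R (rise ∷ P)) (ℕ.+-suc _ _)
length-flip d       (fall ∷ R)   P = trans (length-flip (suc d) R (fall ∷ P)) (ℕ.+-suc _ _)
length-flip d       (flat c ∷ R) P = trans (length-flip d R (flat c ∷ P)) (ℕ.+-suc _ _)

flip-++ : ∀ {k} d (R P Q : Path k) → flip d R (P ++ Q) ≡ flip d R P ++ Q
flip-++ d       []           P Q = refl
flip-++ zero    (rise ∷ R)   P Q = flip-++ zero R (fall ∷ P) Q
flip-++ (suc d) (rise ∷ R)   P Q = flip-++ d R (rise ∷ P) Q
flip-++ d       (fall ∷ R)   P Q = flip-++ (suc d) R (fall ∷ P) Q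
flip-++ d       (flat c ∷ R) P Q = flip-++ d R (flat c ∷ P) Q

length-unflip : ∀ {k} d (P R : Path k) → length (unflip d P R) ≡ length P + length R
length-unflip d       []           R = refl
length-unflip zero    (fall ∷ P)   R = trans (length-unflip zero P (rise ∷ R)) (ℕ.+-suc _ _)
length-unflip (suc d) (fall ∷ P)   R = trans (length-unflip d P (fall ∷ R)) (ℕ.+-suc _ _)
length-unflip d       (rise ∷ P)   R = trans (length-unflip (suc d) P (rise ∷ R)) (ℕ.+-suc _ _)
length-unflip d       (flat c ∷ P) R = trans (length-unflip d P (flat c ∷ R)) (ℕ.+-suc _ _)

-- The cut is made at the last rise from height a to height a + 1.
split-last-rise : ∀ {k} a b (R : Path k) → Up R (b + suc a) →
  ∃₂ λ S T → R ≡ S ++ rise ∷ T × Up S b × Up T a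
split-last-rise a zero    (rise ∷ R) (rise u) = [] , R , refl , [] , u
split-last-rise a (suc b) (rise ∷ R) (rise u) with split-last-rise a b R u
... | S , T , refl , v , w = rise ∷ S , T , refl , rise v , w
split-last-rise a b (fall ∷ R) (fall u) with split-last-rise a (suc b) R u
... | S , T , refl , v , w = fall ∷ S , T , refl , fall v , w
split-last-rise a b (flat c ∷ R) (flat u) with split-last-rise a b R u
... | S , T , refl , v , w = flat c ∷ S , T , refl , flat v , w

-- Two different cuts would pair the end of one piece with a `rise` inside the other at b = 0, and
-- `Up` admits no `rise` ending at height 0. All other mismatches are between distinct steps.
split-unique : ∀ {k} {S S′ T T′ : Path k} {b} → Up S b → Up S′ b →
  S ++ rise ∷ T ≡ S′ ++ rise ∷ T′ → S ≡ S′
split-unique []       []        eq = refl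
split-unique (rise u) (rise u′) eq = cong (rise ∷_) (split-unique u u′ (List.∷-injectiveʳ eq))
split-unique (fall u) (fall u′) eq = cong (fall ∷_) (split-unique u u′ (List.∷-injectiveʳ eq))
split-unique (flat u) (flat u′) eq with List.∷-injective eq
... | refl , eq′ = cong (flat _ ∷_) (split-unique u u′ eq′)
split-unique (flat u) (rise u′) eq with () ← List.∷-injectiveˡ eq
split-unique (flat u) (fall u′) eq with () ← List.∷-injectiveˡ eq
split-unique (rise u) (flat u′) eq with () ← List.∷-injectiveˡ eq
split-unique (fall u) (flat u′) eq with () ← List.∷-injectiveˡ eq
split-unique (fall u) (rise u′) eq with () ← List.∷-injectiveˡ eq
split-unique (rise u) (fall u′) eq with () ← List.∷-injectiveˡ eq
split-unique []       (fall u)  eq with () ← List.∷-injectiveˡ eq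
split-unique []       (flat u)  eq with () ← List.∷-injectiveˡ eq
split-unique (fall u) []        eq with () ← List.∷-injectiveˡ eq
split-unique (flat u) []        eq with () ← List.∷-injectiveˡ eq

-- The prefix, last step first, from which the algorithm obtains w by a cyclic
-- shift that puts j steps of w after the chosen minimum.
preimage : ∀ {k} → Path k → ℕ → Path k
preimage w j = reverse (take j w) ++ rise ∷ unflip 0 (drop j w) []

double-injective : ∀ i j → i + i ≡ j + j → i ≡ j
double-injective zero    zero    eq = refl
double-injective (suc i) (suc j) eq = cong suc (double-injective i j
  (ℕ.suc-injective (trans (sym (ℕ.+-suc i i)) (trans (ℕ.suc-injective eq) (ℕ.+-suc j j)))))

preimage-Up : ∀ {k} {w : Path k} j {i} → Up (reverse (take j w)) i → Down (drop j w) i →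
  Up (preimage w j) (suc (i + i))
preimage-Up {w = w} j {i} u d = castUp (ℕ.+-suc i i)
  (Up-++ u (rise (unflip-Up 0 {i} 0 [] (castDown (sym (ℕ.+-identityʳ i)) d))))

-- The preimage determines the cut: its final height 2i + 1 gives i, hence by `split-unique` the
-- piece after the cut, whose length is the position.
preimage-injective : ∀ {k} {w : Path k} {i j} → Down w 0 → i ≤ length w → j ≤ length w →
  preimage w i ≡ preimage w j → i ≡ j
preimage-injective {w = w} {i} {j} d i≤ j≤ eq
  with Down-split [] d i | Down-split [] d j
... | a , u , v | b , u′ , v′
  with double-injective a b (ℕ.suc-injective
         (Up-unique (preimage-Up i u v) (subst (λ R → Up R _) (sym eq) (preimage-Up j u′ v′))))
... | refl = begin
  i                              ≡⟨ len i i≤ ⟨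
  length (reverse (take i w))    ≡⟨ cong length (split-unique u u′ eq) ⟩
  length (reverse (take j w))    ≡⟨ len j j≤ ⟩
  j                              ∎
  where
  open ≡-Reasoning
  len : ∀ m → m ≤ length w → length (reverse (take m w)) ≡ m
  len m m≤ = trans (List.length-reverse (take m w))
    (trans (List.length-take m w) (ℕ.m≤n⇒m⊓n≡m m≤))

preimage-length : ∀ {k} (w : Path k) j → length (preimage w j) ≡ suc (length w)
preimage-length w j = begin
  length (reverse A ++ rise ∷ unflip 0 B [])
    ≡⟨ List.length-++ (reverse A) ⟩
  length (reverse A) + suc (length (unflip 0 B []))
    ≡⟨ cong₂ (λ x y → x + suc y) (List.length-reverse A)
         (trans (length-unflip 0 B []) (ℕ.+-identityʳ _)) ⟩
  length A + suc (length B)      ≡⟨ ℕ.+-suc _ _ ⟩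
  suc (length A + length B)      ≡⟨ cong suc (List.length-++ A) ⟨
  suc (length (A ++ B))          ≡⟨ cong (λ x → suc (length x)) (List.take++drop≡id j w) ⟩
  suc (length w)                 ∎
  where
  open ≡-Reasoning
  A = take j w
  B = drop j w

-- Output of the algorithm, in terms of the decomposition S ++ rise ∷ T.
rotate : ∀ {k} → Path k → Path k → Path k
rotate S T = S ʳ++ flip 0 T []

rotate-Down : ∀ {k} {S T : Path k} {i} → Up S i → Up T i → Down (rotate S T) 0
rotate-Down {i = i} u v =
  Up-ʳ++ u (flip-Down i {0} 0 (castUp (sym (ℕ.+-identityʳ i)) v) [])

rotate-length : ∀ {k} (S T : Path k) → length (rotate S T) ≡ length S + length T
rotate-length S T = trans (List.length-ʳ++ S)
  (cong (λ x → length S + x) (trans (length-flip 0 T []) (ℕ.+-identityʳ _)))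

-- With `rotate-preimage`, this matches odd prefixes with pairs of a Motzkin path and a cut
-- position, the position being the length of the piece after the cut.
preimage-rotate : ∀ {k} {S T : Path k} {i} → Up S i → Up T i →
  preimage (rotate S T) (length S) ≡ S ++ rise ∷ T
preimage-rotate {S = S} {T} {i} u v = cong₂ (λ X Y → X ++ rise ∷ Y)
  (trans (cong reverse takeS) (List.reverse-involutive S))
  (trans (cong (λ X → unflip 0 X []) dropS)
         (unflip-flip i 0 T [] (castUp (sym (ℕ.+-identityʳ i)) v)))
  where
  F = flip 0 T []
  lenS = List.length-reverse S
  takeS : take (length S) (rotate S T) ≡ reverse S
  takeS = trans (cong₂ take (sym lenS) (List.ʳ++-defn S)) (take-length-++ (reverse S) F)
  dropS : drop (length S) (rotate S T) ≡ F
  dropS = trans (cong₂ drop (sym lenS) (List.ʳ++-defn S)) (drop-length-++ (reverse S) F)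

rotate-preimage : ∀ {k} {w : Path k} j {i} → Down (drop j w) i →
  rotate (reverse (take j w)) (unflip 0 (drop j w) []) ≡ w
rotate-preimage {w = w} j {i} d = begin
  reverse A ʳ++ flip 0 (unflip 0 B []) []
    ≡⟨ cong (reverse A ʳ++_) (flip-unflip i 0 B [] (castDown (sym (ℕ.+-identityʳ i)) d)) ⟩
  reverse A ʳ++ B          ≡⟨ List.ʳ++-defn (reverse A) ⟩
  reverse (reverse A) ++ B ≡⟨ cong (_++ B) (List.reverse-involutive A) ⟩
  A ++ B                   ≡⟨ List.take++drop≡id j w ⟩
  w                        ∎
  where
  open ≡-Reasoning
  A = take j w
  B = drop j w

-- Programs without draws

-- p draws nothing, performs at most c operations and returns a.
data Within {k A} : ℕ → Prog k A → A → Set where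
  ret : ∀ {c a} → Within c (ret a) a
  op  : ∀ {c p a} → Within c p a → Within (suc c) (op p) a

weaken : ∀ {k A c d} {p : Prog k A} {a} → c ≤ d → Within c p a → Within d p a
weaken c≤d       ret    = ret
weaken (s≤s c≤d) (op w) = op (weaken c≤d w)

cost≡ : ∀ {k A c d} {p : Prog k A} {a} → c ≡ d → Within c p a → Within d p a
cost≡ refl w = w

prog≡ : ∀ {k A c} {p q : Prog k A} {a} → p ≡ q → Within c p a → Within c q a
prog≡ refl w = w

value≡ : ∀ {k A c} {p : Prog k A} {a b} → a ≡ b → Within c p a → Within c p b
value≡ refl w = w

bind : ∀ {k A B c d} {p : Prog k A} {f : A → Prog k B} {a b} →
  Within c p a → Within d (f a) b → Within (c + d) (p >>= f) b
bind {c = c} {d} ret w = weaken (ℕ.m≤n+m d c) w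
bind (op v) w = op (bind v w)

-- Γ as a backward scan

scan-last-rise : ∀ {k t ℓ h c r} {R acc : Path k} → h ≡ ℓ →
  Within c (scanΓ t (ℓ ℤ.- 1ℤ) (h ℤ.- 1ℤ) R ((if does (ℓ ℤ.≤? t) then fall else rise) ∷ acc)) r →
  Within (7 + c) (scanΓ t ℓ h (rise ∷ R) acc) r
scan-last-rise {ℓ = ℓ} {h} eq w with h ℤ.≟ ℓ
... | yes _ = op (op (op (op (op (op (op w))))))
... | no ≢  = contradiction eq ≢

-- A last rise takes the longest branch of `scanΓ`, seven operations. The shorter branches are
-- padded to seven, so that the cost depends on the length alone.
scan-other-rise : ∀ {k t ℓ h c r} {R acc : Path k} → h ≢ ℓ →
  Within c (scanΓ t ℓ (h ℤ.- 1ℤ) R (rise ∷ acc)) r →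
  Within (7 + c) (scanΓ t ℓ h (rise ∷ R) acc) r
scan-other-rise {ℓ = ℓ} {h} {c} ≢ w with h ℤ.≟ ℓ
... | yes eq = contradiction eq ≢
... | no _   = op (op (op (op (weaken (ℕ.m≤n+m c 3) w))))

scan-fall : ∀ {k t ℓ h′ c r} {R acc : Path k} h → h ℤ.+ 1ℤ ≡ h′ →
  Within c (scanΓ t ℓ h′ R (fall ∷ acc)) r →
  Within (7 + c) (scanΓ t ℓ h (fall ∷ R) acc) r
scan-fall {c = c} h refl w = op (op (op (weaken (ℕ.m≤n+m c 4) w)))

scan-flat : ∀ {k t ℓ h c r x} {R acc : Path k} →
  Within c (scanΓ t ℓ h R (flat x ∷ acc)) r →
  Within (7 + c) (scanΓ t ℓ h (flat x ∷ R) acc) r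
scan-flat {c = c} w = op (op (weaken (ℕ.m≤n+m c 5) w))

+[n+1] : ∀ n → + n ℤ.+ 1ℤ ≡ + suc n
+[n+1] n = cong +_ (ℕ.+-comm n 1)

-- Above level t every step is kept.
scan-high : ∀ {k t e a c r} {S R acc : Path k} → Up S a → e ≤ a →
  Within c (scanΓ (+ t) (+ t) (+ t) R (S ʳ++ acc)) r →
  Within (length S * 7 + c) (scanΓ (+ t) (+ (e + t)) (+ (a + t)) (S ++ R) acc) r
scan-high [] z≤n w = w
scan-high {t = t} {e} {suc a} {R = R} {acc} (rise {R = S} u) e≤ w with e ℕ.≟ suc a
... | yes refl = scan-last-rise refl
  (subst (λ s → Within _ (scanΓ (+ t) (+ (a + t)) (+ (a + t)) (S ++ R) (s ∷ acc)) _)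
    (sym (cong (λ b → if b then fall else rise) (dec-false (+ (suc a + t) ℤ.≤? + t) high)))
    (scan-high u ℕ.≤-refl w))
  where
  high : ¬ (+ (suc a + t) ℤ.≤ + t)
  high (ℤ.+≤+ le) = ℕ.m+n≮n a t le
... | no ≢ = scan-other-rise (λ eq → ≢ (sym (ℕ.+-cancelʳ-≡ t _ _ (ℤ.+-injective eq))))
  (scan-high u (ℕ.≤-pred (ℕ.≤∧≢⇒< e≤ ≢)) w)
scan-high {t = t} {a = a} (fall u) e≤ w =
  scan-fall (+ (a + t)) (+[n+1] (a + t)) (scan-high u (ℕ.m≤n⇒m≤1+n e≤) w)
scan-high (flat u) e≤ w = scan-flat (scan-high u e≤ w)

-- From level t downwards every U is replaced, so the scan performs exactly `flip`: ℓ is the least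
-- height met and d the excess of the current height over it.
scan-low : ∀ {k t} ℓ d {T acc : Path k} → Up T (d + ℓ) → ℓ ≤ t →
  Within (length T * 7 + 1) (scanΓ (+ t) (+ ℓ) (+ (d + ℓ)) T acc) (flip d T acc)
scan-low ℓ d {[]} u le = op ret
scan-low {t = t} (suc ℓ) zero {rise ∷ T} {acc} (rise u) le = scan-last-rise refl
  (subst (λ s → Within _ (scanΓ (+ t) (+ ℓ) (+ ℓ) T (s ∷ acc)) _)
    (sym (cong (λ b → if b then fall else rise) (dec-true (+ suc ℓ ℤ.≤? + t) (ℤ.+≤+ le))))
    (scan-low ℓ 0 u (ℕ.<⇒≤ le)))
scan-low ℓ (suc d) (rise u) le =
  scan-other-rise (λ eq → ℕ.m+1+n≢n d (trans (ℕ.+-suc d ℓ) (ℤ.+-injective eq)))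
    (scan-low ℓ d u le)
scan-low ℓ d (fall u) le = scan-fall (+ (d + ℓ)) (+[n+1] (d + ℓ)) (scan-low ℓ (suc d) u le)
scan-low ℓ d (flat u) le = scan-flat (scan-low ℓ d u le)

private
  half : ∀ i → suc (i + i) ℕ./ 2 ≡ i
  half i = trans (cong (λ x → suc x ℕ./ 2) (trans (cong (λ y → i + y) (sym (ℕ.+-identityʳ i))) (ℕ.*-comm 2 i)))
    (trans (+-distrib-/-∣ʳ 1 {i * 2} {2} (divides i refl)) (m*n/n≡m i 2))

-- The last rise from height i to height i + 1 is the highest one to be replaced.
gamma-split : ∀ {k i} {S T : Path k} → Up S i → Up T i →
  Within (length S * 7 + (length T * 7 + 10))
    (gamma (S ++ rise ∷ T) (+ suc (i + i))) (flip 0 T [] ++ fall ∷ reverse S)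
gamma-split {i = i} {S} {T} u v = weaken (ℕ.≤-reflexive (arith (length S) (length T)))
  (op (op (subst₂ (λ t h → Within (length S * 7 + (7 + (length T * 7 + 1)))
             (scanΓ t h h (S ++ rise ∷ T) []) (flip 0 T [] ++ fall ∷ reverse S))
    (sym (trans (cong (λ x → + x ℤ.+ 1ℤ) (half i)) (+[n+1] i)))
    (cong +_ (ℕ.+-suc i i))
    (scan-high {t = suc i} u ℕ.≤-refl (scan-last-rise refl
      (subst₂ (λ s r → Within _ (scanΓ (+ suc i) (+ i) (+ i) T (s ∷ reverse S)) r)
        (sym (cong (λ b → if b then fall else rise) (dec-true (+ suc i ℤ.≤? + suc i) ℤ.≤-refl)))
        (flip-++ 0 T [] (fall ∷ reverse S))
        (scan-low i 0 v (ℕ.n≤1+n i))))))))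
  where
  arith : ∀ s t → 2 + (s * 7 + (7 + (t * 7 + 1))) ≡ s * 7 + (t * 7 + 10)
  arith = solve-∀

-- Locating the minimum and shifting

firstMin-keep : ∀ {k p S′ μ q c r} {P : Path k} S s → S ℤ.+ encode s ≡ S′ → μ ℤ.≤ S′ →
  Within c (firstMin (suc p) S′ μ q P) r → Within (5 + c) (firstMin p S μ q (s ∷ P)) r
firstMin-keep {μ = μ} S s refl le w with S ℤ.+ encode s ℤ.<? μ
... | yes lt = contradiction le (ℤ.<⇒≱ lt)
... | no _   = op (op (op (op (op w))))

firstMin-new : ∀ {k p S′ μ q c r} {P : Path k} S s → S ℤ.+ encode s ≡ S′ → S′ ℤ.< μ →
  Within c (firstMin (suc p) S′ S′ (suc p) P) r → Within (5 + c) (firstMin p S μ q (s ∷ P)) r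
firstMin-new {μ = μ} S s refl lt w with S ℤ.+ encode s ℤ.<? μ
... | yes _ = op (op (op (op (op w))))
... | no ≮  = contradiction lt ≮

+-swap : ∀ a b c → a + (b + c) ≡ b + a + c
+-swap = solve-∀

private
  b+h+1 : ∀ b h → b ℤ.+ + h ℤ.+ 1ℤ ≡ b ℤ.+ + suc h
  b+h+1 b h = trans (ℤ.+-assoc b (+ h) 1ℤ) (cong (λ x → b ℤ.+ x) (+[n+1] h))

  b+h-1 : ∀ b h → b ℤ.+ + suc h ℤ.+ -1ℤ ≡ b ℤ.+ + h
  b+h-1 b h = ℤ.+-assoc b (+ suc h) -1ℤ

  b≤b+h : ∀ b h → b ℤ.≤ b ℤ.+ + h
  b≤b+h b h = ℤ.i≤i+j b (+ h)

-- As long as the path stays at or above b, so does the running minimum.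
firstMin-above : ∀ {k p μ q c r} {P : Path k} S s b h → S ℤ.+ encode s ≡ b ℤ.+ + h → b ℤ.≤ μ →
  (∀ {μ q} → b ℤ.≤ μ → Within c (firstMin (suc p) (b ℤ.+ + h) μ q P) r) →
  Within (5 + c) (firstMin p S μ q (s ∷ P)) r
firstMin-above {μ = μ} S s b h eq b≤μ w with b ℤ.+ + h ℤ.<? μ
... | yes lt = firstMin-new S s eq lt (w (b≤b+h b h))
... | no ≮  = firstMin-keep S s eq (ℤ.≮⇒≥ ≮) (w b≤μ)

-- Where the minimum lies inside P is irrelevant, since the next step will go strictly below b.
-- Hence the continuation is asked to work for every μ ≥ b and every q.
firstMin-down : ∀ {k h p μ q c r} {P Q : Path k} b → Down P h → b ℤ.≤ μ →
  (∀ {μ q} → b ℤ.≤ μ → Within c (firstMin (length P + p) b μ q Q) r) →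
  Within (length P * 5 + c) (firstMin p (b ℤ.+ + h) μ q (P ++ Q)) r
firstMin-down {Q = Q} b [] b≤ w =
  prog≡ (cong (λ x → firstMin _ x _ _ Q) (sym (ℤ.+-identityʳ b))) (w b≤)
firstMin-down {h = h} {p} {P = s ∷ P} {Q} b (rise d) b≤ w =
  firstMin-above (b ℤ.+ + h) s b (suc h) (b+h+1 b h) b≤ λ le → firstMin-down b d le λ {μ} {q} le →
    prog≡ (cong (λ x → firstMin x b μ q Q) (sym (ℕ.+-suc (length P) p))) (w le)
firstMin-down {h = suc h} {p} {P = s ∷ P} {Q} b (fall d) b≤ w =
  firstMin-above (b ℤ.+ + suc h) s b h (b+h-1 b h) b≤ λ le → firstMin-down b d le λ {μ} {q} le →
    prog≡ (cong (λ x → firstMin x b μ q Q) (sym (ℕ.+-suc (length P) p))) (w le)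
firstMin-down {h = h} {p} {P = s ∷ P} {Q} b (flat d) b≤ w =
  firstMin-above (b ℤ.+ + h) s b h (ℤ.+-identityʳ _) b≤ λ le → firstMin-down b d le λ {μ} {q} le →
    prog≡ (cong (λ x → firstMin x b μ q Q) (sym (ℕ.+-suc (length P) p))) (w le)

-- Starting at the minimum b, the path never goes strictly below it, so the recorded position q
-- survives to the end of S.
firstMin-up : ∀ {k h p q c r} {S P : Path k} b → Up S h →
  Within c (firstMin (length S + p) (b ℤ.+ + h) b q P) r →
  Within (length S * 5 + c) (firstMin p b b q (S ʳ++ P)) r
firstMin-up {p = p} {q} {P = P} b [] w =
  prog≡ (cong (λ x → firstMin p x b q P) (ℤ.+-identityʳ b)) w
firstMin-up {h = suc h} {c = c} {S = s ∷ S} b (rise u) w =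
  cost≡ (+-swap (length S * 5) 5 c)
    (firstMin-up b u (firstMin-keep (b ℤ.+ + h) s (b+h+1 b h) (b≤b+h b (suc h)) w))
firstMin-up {h = h} {c = c} {S = s ∷ S} b (fall u) w =
  cost≡ (+-swap (length S * 5) 5 c)
    (firstMin-up b u (firstMin-keep (b ℤ.+ + suc h) s (b+h-1 b h) (b≤b+h b h) w))
firstMin-up {h = h} {c = c} {S = s ∷ S} b (flat u) w =
  cost≡ (+-swap (length S * 5) 5 c)
    (firstMin-up b u (firstMin-keep (b ℤ.+ + h) s (ℤ.+-identityʳ _) (b≤b+h b h) w))

firstMin-split : ∀ {k i} {P S : Path k} → Down P i → Up S i →
  Within (length P * 5 + (length S * 5 + 6))
    (firstMin 0 0ℤ 0ℤ 0 (P ++ fall ∷ reverse S)) (suc (length P))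
firstMin-split {i = i} {P} {S} d u =
  -- With floor b = - i the start is b + i and P ends on the floor. The following `fall` is strictly
  -- below everything before it and `reverse S` never goes lower, so the minimum is first attained
  -- just after that `fall`.
  prog≡ (cong (λ x → firstMin 0 x 0ℤ 0 (P ++ fall ∷ reverse S)) (ℤ.+-inverseˡ (+ i)))
    (firstMin-down b d ℤ.neg-≤-pos λ le →
      cost≡ (sym (+-swap (length S * 5) 5 1))
      (firstMin-new b fall refl (ℤ.<-≤-trans below le)
        (firstMin-up (b ℤ.+ -1ℤ) u
          (op (value≡ (cong suc (ℕ.+-identityʳ (length P))) (ret {c = 0}))))))
  where
  b = ℤ.- + i
  below : b ℤ.+ -1ℤ ℤ.< b
  below = subst (λ x → b ℤ.+ -1ℤ ℤ.< x) (ℤ.+-identityʳ b) (ℤ.+-monoʳ-< b ℤ.-<+)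

takeᵖ-within : ∀ {k} m (P : Path k) → Within (m * 2 + 1) (takeᵖ m P) (take m P)
takeᵖ-within zero    P       = op ret
takeᵖ-within (suc m) []      = op ret
takeᵖ-within (suc m) (s ∷ P) = op (weaken (ℕ.≤-reflexive (move m)) (bind (takeᵖ-within m P) (op (ret {c = 0}))))
  where
  move : ∀ m → m * 2 + 1 + 1 ≡ suc (m * 2 + 1)
  move = solve-∀

dropᵖ-within : ∀ {k} m (P : Path k) → Within (m + 1) (dropᵖ m P) (drop m P)
dropᵖ-within zero    P       = op ret
dropᵖ-within (suc m) []      = op ret
dropᵖ-within (suc m) (s ∷ P) = op (dropᵖ-within m P)

appendᵖ-within : ∀ {k} (P Q : Path k) → Within (length P * 2 + 1) (appendᵖ P Q) (P ++ Q)
appendᵖ-within []      Q = op ret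
appendᵖ-within (s ∷ P) Q = op (weaken (ℕ.≤-reflexive (move (length P))) (bind (appendᵖ-within P Q) (op (ret {c = 0}))))
  where
  move : ∀ m → m * 2 + 1 + 1 ≡ suc (m * 2 + 1)
  move = solve-∀

shift-split : ∀ {k i} {P S : Path k} → Down P i → Up S i →
  Within ((length S + length P) * 10 + 13) (shift (length S + length P) (P ++ fall ∷ reverse S))
    (S ʳ++ P)
shift-split {P = P} {S} d u = weaken cost≤
  (bind (firstMin-split d u)
  (bind (subst (Within _ _) drop≡ (dropᵖ-within (suc (length P)) G))
  (bind (subst (Within _ _) take≡ (takeᵖ-within (suc (length P)) G))
  (bind (appendᵖ-within (reverse S) (P ++ fall ∷ []))
    (subst (Within _ _) result (takeᵖ-within n _))))))
  where
  n = length S + length P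
  G = P ++ fall ∷ reverse S
  P↓ = P ++ fall ∷ []
  G≡ : P↓ ++ reverse S ≡ G
  G≡ = List.++-assoc P (fall ∷ []) (reverse S)
  len : length P↓ ≡ suc (length P)
  len = trans (List.length-++ P) (ℕ.+-comm (length P) 1)
  drop≡ : drop (suc (length P)) G ≡ reverse S
  drop≡ = trans (cong₂ drop (sym len) (sym G≡)) (drop-length-++ P↓ (reverse S))
  take≡ : take (suc (length P)) G ≡ P↓
  take≡ = trans (cong₂ take (sym len) (sym G≡)) (take-length-++ P↓ (reverse S))
  -- The shift brings the cut `fall` to the very end, and keeping n steps removes it.
  result : take n (reverse S ++ P↓) ≡ S ʳ++ P
  result = trans (cong₂ take
      (sym (trans (List.length-++ (reverse S)) (cong (_+ length P) (List.length-reverse S))))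
      (sym (List.++-assoc (reverse S) P (fall ∷ []))))
    (trans (take-length-++ (reverse S ++ P) (fall ∷ [])) (sym (List.ʳ++-defn S)))
  -- The actual total is 9 s + 10 p + 13 for lengths s and p of S and P; a further s makes it a
  -- function of s + p.
  cost≤ : length P * 5 + (length S * 5 + 6) + (suc (length P) + 1 + (suc (length P) * 2 + 1 +
          (length (reverse S) * 2 + 1 + (n * 2 + 1)))) ≤ n * 10 + 13
  cost≤ rewrite List.length-reverse S =
    ℕ.≤-trans (ℕ.m≤m+n _ (length S)) (ℕ.≤-reflexive (arith (length S) (length P)))
    where
    arith : ∀ s p → p * 5 + (s * 5 + 6) + (suc p + 1 + (suc p * 2 + 1 +
              (s * 2 + 1 + ((s + p) * 2 + 1)))) + s ≡ (s + p) * 10 + 13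
    arith = solve-∀

parity-even : ∀ i → (i + i) % 2 ≡ 0
parity-even i = trans (cong (_% 2) (double i)) ([m+kn]%n≡m%n 0 i 2)
  where
  double : ∀ i → i + i ≡ 0 + i * 2
  double = solve-∀

parity-odd : ∀ i → suc (i + i) % 2 ≡ 1
parity-odd i = trans (cong (_% 2) (double i)) ([m+kn]%n≡m%n 1 i 2)
  where
  double : ∀ i → suc (i + i) ≡ 1 + i * 2
  double = solve-∀

fromPrefix-even : ∀ {k n i} {R : Path k} → Within 2 (fromPrefix n (just (R , + (i + i)))) nothing
fromPrefix-even {i = i} rewrite parity-even i = op (op ret)

fromPrefix-continue : ∀ {k n h c r} {R : Path k} → h ℤ.%ℕ 2 ≡ 1 →
  Within c (gamma R h >>= λ G → shift n G >>= λ w → ret (just w)) r →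
  Within (2 + c) (fromPrefix n (just (R , h))) r
fromPrefix-continue eq w rewrite eq = op (op w)

-- Per step, 17 = 7 + 10 for `gamma` and `shift`; the constant 25 = 2 + 10 + 13 adds the parity test
-- to their constant parts.
fromPrefix-odd : ∀ {k i} {S T : Path k} → Up S i → Up T i →
  Within ((length S + length T) * 17 + 25)
    (fromPrefix (length S + length T) (just (S ++ rise ∷ T , + suc (i + i))))
    (just (rotate S T))
fromPrefix-odd {i = i} {S} {T} u v =
  cost≡ (arith (length S) (length T))
    (fromPrefix-continue {h = + suc (i + i)} {R = S ++ rise ∷ T} (parity-odd i)
      (bind {f = λ G → shift (length S + length T) G >>= λ w → ret (just w)} (gamma-split u v)
            (bind {d = 0} {f = λ w → ret (just w)} shifted ret)))
  where
  arith : ∀ s t → suc (suc (s * 7 + (t * 7 + 10) + ((s + t) * 10 + 13 + 0))) ≡ (s + t) * 17 + 25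
  arith = solve-∀
  F = flip 0 T []
  shifted : Within ((length S + length T) * 10 + 13)
              (shift (length S + length T) (F ++ fall ∷ reverse S)) (rotate S T)
  shifted = subst (λ x → Within ((length S + x) * 10 + 13)
                           (shift (length S + x) (F ++ fall ∷ reverse S)) (rotate S T))
    (trans (length-flip 0 T []) (ℕ.+-identityʳ _))
    (shift-split (flip-Down i 0 (subst (Up T) (sym (ℕ.+-identityʳ i)) v) []) u)

-- Expectations

-- Generic in the monoid because the same sums occur over ℕ, for counting, and over ℚ, for
-- expectations. Over ℚ, `∑` unfolds to the very fold used in `mean`.
module Sum (M : CommutativeMonoid 0ℓ 0ℓ) where
  open CommutativeMonoid M renaming (Carrier to C; refl to ≈-refl; sym to ≈-sym; trans to ≈-trans)
  open import Algebra.Properties.CommutativeSemigroup commutativeSemigroup using (interchange)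

  ∑ : ∀ {A : Set} → List A → (A → C) → C
  ∑ xs f = foldr _∙_ ε (map f xs)

  ∑-cong : ∀ {A : Set} (xs : List A) {f g : A → C} → (∀ x → f x ≈ g x) → ∑ xs f ≈ ∑ xs g
  ∑-cong []       eq = ≈-refl
  ∑-cong (x ∷ xs) eq = ∙-cong (eq x) (∑-cong xs eq)

  ∑-cong-∈ : ∀ {A : Set} (xs : List A) {f g : A → C} → (∀ {x} → x ∈ xs → f x ≈ g x) → ∑ xs f ≈ ∑ xs g
  ∑-cong-∈ []       eq = ≈-refl
  ∑-cong-∈ (x ∷ xs) eq = ∙-cong (eq (here refl)) (∑-cong-∈ xs (eq ∘ there))

  ∑-ε : ∀ {A : Set} (xs : List A) → ∑ xs (λ _ → ε) ≈ ε
  ∑-ε []       = ≈-refl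
  ∑-ε (x ∷ xs) = ≈-trans (identityˡ _) (∑-ε xs)

  ∑-∙ : ∀ {A : Set} (xs : List A) {f g : A → C} → ∑ xs (λ x → f x ∙ g x) ≈ ∑ xs f ∙ ∑ xs g
  ∑-∙ []       = ≈-sym (identityˡ _)
  ∑-∙ (x ∷ xs) = ≈-trans (∙-congˡ (∑-∙ xs)) (interchange _ _ _ _)

  ∑-swap : ∀ {A B : Set} (xs : List A) (ys : List B) {f : A → B → C} →
    ∑ xs (λ x → ∑ ys (f x)) ≈ ∑ ys (λ y → ∑ xs (λ x → f x y))
  ∑-swap []       ys = ≈-sym (∑-ε ys)
  ∑-swap (x ∷ xs) ys = ≈-trans (∙-congˡ (∑-swap xs ys)) (≈-sym (∑-∙ ys))

  ∑-++ : ∀ {A : Set} (xs ys : List A) {f : A → C} → ∑ (xs ++ ys) f ≈ ∑ xs f ∙ ∑ ys f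
  ∑-++ []       ys = ≈-sym (identityˡ _)
  ∑-++ (x ∷ xs) ys = ≈-trans (∙-congˡ (∑-++ xs ys)) (≈-sym (assoc _ _ _))

  ∑-map : ∀ {A B : Set} (h : A → B) (xs : List A) {f : B → C} → ∑ (map h xs) f ≈ ∑ xs (f ∘ h)
  ∑-map h []       = ≈-refl
  ∑-map h (x ∷ xs) = ∙-congˡ (∑-map h xs)

  ∑-concatMap : ∀ {A B : Set} (h : A → List B) (xs : List A) {f : B → C} →
    ∑ (concatMap h xs) f ≈ ∑ xs (λ x → ∑ (h x) f)
  ∑-concatMap h []       = ≈-refl
  ∑-concatMap h (x ∷ xs) = ≈-trans (∑-++ (h x) (concatMap h xs)) (∙-congˡ (∑-concatMap h xs))

  ∑-words : ∀ {k} n {f : Path k → C} →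
    ∑ (words k (suc n)) f ≈ ∑ (steps k) (λ s → ∑ (words k n) (f ∘ (s ∷_)))
  ∑-words {k} n {f} = ≈-trans (∑-concatMap (λ s → map (s ∷_) (words k n)) (steps k) {f})
    (∑-cong (steps k) (λ s → ∑-map (s ∷_) (words k n) {f}))

open Sum ℕ.+-0-commutativeMonoid
open Sum ℚ.+-0-commutativeMonoid using () renaming
  (∑ to ∑ᴿ; ∑-cong to ∑ᴿ-cong; ∑-cong-∈ to ∑ᴿ-cong-∈; ∑-∙ to ∑ᴿ-+; ∑-swap to ∑ᴿ-swap; ∑-words to ∑ᴿ-words)

ι : ℕ → ℚ
ι n = + n ℚ./ 1

private
  fromℕ : ℕ → ℚ
  fromℕ n = mkℚ (+ n) 0 (Coprimality.sym (Coprimality.1-coprimeTo n))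

  ι≡ : ∀ n → ι n ≡ fromℕ n
  ι≡ n = ℚ.normalize-coprime (Coprimality.sym (Coprimality.1-coprimeTo n))

ι-+ : ∀ m n → ι (m + n) ≡ ι m ℚ.+ ι n
ι-+ m n = sym (trans (cong₂ ℚ._+_ (ι≡ m) (ι≡ n))
  (cong (ℚ._/ 1) (cong₂ ℤ._+_ (ℤ.*-identityʳ (+ m)) (ℤ.*-identityʳ (+ n)))))

ι-* : ∀ m n → ι (m * n) ≡ ι m ℚ.* ι n
ι-* m n = sym (trans (cong₂ ℚ._*_ (ι≡ m) (ι≡ n)) (cong (ℚ._/ 1) (sym (ℤ.pos-* m n))))

ι-mono : ∀ {m n} → m ≤ n → ι m ℚ.≤ ι n
ι-mono {m} {n} le = subst₂ ℚ._≤_ (sym (ι≡ m)) (sym (ι≡ n))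
  (ℚ.*≤* (subst₂ ℤ._≤_ (sym (ℤ.*-identityʳ (+ m))) (sym (ℤ.*-identityʳ (+ n))) (ℤ.+≤+ le)))

0≤ι : ∀ n → 0ℚ ℚ.≤ ι n
0≤ι n = ι-mono {0} {n} z≤n

∑-ι : ∀ {A : Set} (xs : List A) {f : A → ℕ} → ∑ᴿ xs (ι ∘ f) ≡ ι (∑ xs f)
∑-ι []           = refl
∑-ι (x ∷ xs) {f} = trans (cong (λ y → ι (f x) ℚ.+ y) (∑-ι xs)) (sym (ι-+ (f x) _))

∑ᴿ-* : ∀ {A : Set} (xs : List A) c {f : A → ℚ} → ∑ᴿ xs (λ x → c ℚ.* f x) ≡ c ℚ.* ∑ᴿ xs f
∑ᴿ-* []       c = sym (ℚ.*-zeroʳ c)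
∑ᴿ-* (x ∷ xs) c {f} = trans (cong (λ y → c ℚ.* f x ℚ.+ y) (∑ᴿ-* xs c)) (sym (ℚ.*-distribˡ-+ c _ _))

∑ᴿ-mono : ∀ {A : Set} (xs : List A) {f g : A → ℚ} →
  (∀ {x} → x ∈ xs → f x ℚ.≤ g x) → ∑ᴿ xs f ℚ.≤ ∑ᴿ xs g
∑ᴿ-mono []       le = ℚ.≤-refl
∑ᴿ-mono (x ∷ xs) le = ℚ.+-mono-≤ (le (here refl)) (∑ᴿ-mono xs (le ∘ there))

∑-const : ∀ {A : Set} (xs : List A) c → ∑ xs (λ _ → c) ≡ length xs * c
∑-const []       c = refl
∑-const (x ∷ xs) c = cong (λ y → c + y) (∑-const xs c)

∑-* : ∀ {A : Set} (xs : List A) c {f : A → ℕ} → ∑ xs (λ x → c * f x) ≡ c * ∑ xs f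
∑-* []       c = sym (ℕ.*-zeroʳ c)
∑-* (x ∷ xs) c {f} = trans (cong (λ y → c * f x + y) (∑-* xs c)) (sym (ℕ.*-distribˡ-+ c _ _))

length-steps : ∀ k → length (steps k) ≡ 2 + k
length-steps k = cong (λ y → 2 + y) (trans (List.length-map flat (allFin k)) (List.length-tabulate (λ i → i)))

inv : ℕ → ℚ
inv k = + 1 ℚ./ (2 + k)

reciprocal-ι : ∀ m → reciprocal (suc m) ℚ.* ι (suc m) ≡ 1ℚ
reciprocal-ι m = trans (cong₂ ℚ._*_ (ℚ.normalize-coprime (Coprimality.1-coprimeTo (suc m))) (ι≡ (suc m)))
  (ℚ.*-inverseʳ (mkℚ (+ 1) m (Coprimality.1-coprimeTo (suc m))))

inv-ι : ∀ k → inv k ℚ.* ι (2 + k) ≡ 1ℚ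
inv-ι k = reciprocal-ι (suc k)

inv-nonNeg : ∀ k → ℚ.NonNegative (inv k)
inv-nonNeg k = ℚ.normalize-nonNeg 1 (2 + k)

mean-cong : ∀ k {f g : Step k → ℚ} → (∀ s → f s ≡ g s) → mean k f ≡ mean k g
mean-cong k eq = cong (inv k ℚ.*_) (∑ᴿ-cong (steps k) eq)

mean-+ : ∀ k (f g : Step k → ℚ) → mean k (λ s → f s ℚ.+ g s) ≡ mean k f ℚ.+ mean k g
mean-+ k f g = trans (cong (inv k ℚ.*_) (∑ᴿ-+ (steps k) {f} {g}))
  (ℚ.*-distribˡ-+ (inv k) (∑ᴿ (steps k) f) (∑ᴿ (steps k) g))

private
  *-swap : ∀ a b c → a ℚ.* (b ℚ.* c) ≡ b ℚ.* (a ℚ.* c)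
  *-swap = solve 3 (λ a b c → a :* (b :* c) := b :* (a :* c)) refl
    where open +-*-Solver

mean-* : ∀ k c (f : Step k → ℚ) → mean k (λ s → c ℚ.* f s) ≡ c ℚ.* mean k f
mean-* k c f = trans (cong (inv k ℚ.*_) (∑ᴿ-* (steps k) c {f})) (*-swap (inv k) c _)

mean-const : ∀ k c → mean k (λ _ → c) ≡ c
mean-const k c = begin
  mean k (λ _ → c)                 ≡⟨ mean-cong k (λ _ → sym (ℚ.*-identityʳ c)) ⟩
  mean k (λ _ → c ℚ.* 1ℚ)          ≡⟨ mean-* k c (λ _ → 1ℚ) ⟩
  c ℚ.* mean k (λ _ → 1ℚ)          ≡⟨ cong (λ x → c ℚ.* (inv k ℚ.* x)) (∑-ι (steps k) {λ _ → 1}) ⟩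
  c ℚ.* (inv k ℚ.* ι (∑ (steps k) (λ _ → 1)))
    ≡⟨ cong (λ x → c ℚ.* (inv k ℚ.* ι x)) (trans (∑-const (steps k) 1) (trans (ℕ.*-identityʳ _) (length-steps k))) ⟩
  c ℚ.* (inv k ℚ.* ι (2 + k))      ≡⟨ cong (c ℚ.*_) (inv-ι k) ⟩
  c ℚ.* 1ℚ                         ≡⟨ ℚ.*-identityʳ c ⟩
  c                                ∎
  where open ≡-Reasoning

mean-mono : ∀ k {f g : Step k → ℚ} → (∀ s → f s ℚ.≤ g s) → mean k f ℚ.≤ mean k g
mean-mono k le = ℚ.*-monoˡ-≤-nonNeg (inv k) {{inv-nonNeg k}} (∑ᴿ-mono (steps k) (λ {s} _ → le s))

mean-swap : ∀ k {f : Step k → Step k → ℚ} →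
  mean k (λ s → mean k (f s)) ≡ mean k (λ s → mean k (λ t → f t s))
mean-swap k {f} = cong (inv k ℚ.*_) (begin
  ∑ᴿ (steps k) (λ s → inv k ℚ.* ∑ᴿ (steps k) (f s))       ≡⟨ ∑ᴿ-* (steps k) (inv k) {λ s → ∑ᴿ (steps k) (f s)} ⟩
  inv k ℚ.* ∑ᴿ (steps k) (λ s → ∑ᴿ (steps k) (f s))       ≡⟨ cong (inv k ℚ.*_) (∑ᴿ-swap (steps k) (steps k) {f}) ⟩
  inv k ℚ.* ∑ᴿ (steps k) (λ s → ∑ᴿ (steps k) (λ t → f t s)) ≡⟨ ∑ᴿ-* (steps k) (inv k) {λ s → ∑ᴿ (steps k) (λ t → f t s)} ⟨
  ∑ᴿ (steps k) (λ s → inv k ℚ.* ∑ᴿ (steps k) (λ t → f t s)) ∎)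
  where open ≡-Reasoning

-- Expected values and costs of programs

Ex : ∀ {k A} → Prog k A → (A → ℚ) → ℚ
Ex     (ret a)  g = g a
Ex     (op p)   g = Ex p g
Ex {k} (draw c) g = mean k (λ s → Ex (c s) g)

Ex-cong : ∀ {k A} (p : Prog k A) {f g : A → ℚ} → (∀ a → f a ≡ g a) → Ex p f ≡ Ex p g
Ex-cong     (ret a)  eq = eq a
Ex-cong     (op p)   eq = Ex-cong p eq
Ex-cong {k} (draw c) eq = mean-cong k (λ s → Ex-cong (c s) eq)

Ex-+ : ∀ {k A} (p : Prog k A) (f g : A → ℚ) → Ex p (λ a → f a ℚ.+ g a) ≡ Ex p f ℚ.+ Ex p g
Ex-+     (ret a)  f g = refl
Ex-+     (op p)   f g = Ex-+ p f g
Ex-+ {k} (draw c) f g =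
  trans (mean-cong k (λ s → Ex-+ (c s) f g)) (mean-+ k (λ s → Ex (c s) f) (λ s → Ex (c s) g))

Ex-* : ∀ {k A} (p : Prog k A) c (f : A → ℚ) → Ex p (λ a → c ℚ.* f a) ≡ c ℚ.* Ex p f
Ex-*     (ret a)  x f = refl
Ex-*     (op p)   x f = Ex-* p x f
Ex-* {k} (draw c) x f =
  trans (mean-cong k (λ s → Ex-* (c s) x f)) (mean-* k x (λ s → Ex (c s) f))

Ex-const : ∀ {k A} (p : Prog k A) c → Ex p (λ _ → c) ≡ c
Ex-const     (ret a)  x = refl
Ex-const     (op p)   x = Ex-const p x
Ex-const {k} (draw c) x = trans (mean-cong k (λ s → Ex-const (c s) x)) (mean-const k x)

Ex-mono : ∀ {k A} (p : Prog k A) {f g : A → ℚ} → (∀ a → f a ℚ.≤ g a) → Ex p f ℚ.≤ Ex p g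
Ex-mono     (ret a)  le = le a
Ex-mono     (op p)   le = Ex-mono p le
Ex-mono {k} (draw c) le = mean-mono k (λ s → Ex-mono (c s) le)

Ex-bind : ∀ {k A B} (p : Prog k A) (f : A → Prog k B) {g : B → ℚ} →
  Ex (p >>= f) g ≡ Ex p (λ a → Ex (f a) g)
Ex-bind     (ret a)  f = refl
Ex-bind     (op p)   f = Ex-bind p f
Ex-bind {k} (draw c) f = mean-cong k (λ s → Ex-bind (c s) f)

Pr-Ex : ∀ {k A} (p : Prog k A) E → Pr p E ≡ Ex p (λ a → if E a then 1ℚ else 0ℚ)
Pr-Ex     (ret a)  E = refl
Pr-Ex     (op p)   E = Pr-Ex p E
Pr-Ex {k} (draw c) E = mean-cong k (λ s → Pr-Ex (c s) E)

meanCost-bind : ∀ {k A B} (p : Prog k A) (f : A → Prog k B) →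
  meanCost (p >>= f) ≡ meanCost p ℚ.+ Ex p (meanCost ∘ f)
meanCost-bind     (ret a)  f = sym (ℚ.+-identityˡ _)
meanCost-bind     (op p)   f = trans (cong (λ y → 1ℚ ℚ.+ y) (meanCost-bind p f))
  (sym (ℚ.+-assoc 1ℚ (meanCost p) (Ex p (meanCost ∘ f))))
meanCost-bind {k} (draw c) f =
  trans (cong (λ y → 1ℚ ℚ.+ y) (trans (mean-cong k (λ s → meanCost-bind (c s) f))
    (mean-+ k (λ s → meanCost (c s)) (λ s → Ex (c s) (meanCost ∘ f)))))
    (sym (ℚ.+-assoc 1ℚ (mean k (λ s → meanCost (c s))) (mean k (λ s → Ex (c s) (meanCost ∘ f)))))

Within-Ex : ∀ {k A c} {p : Prog k A} {a} → Within c p a → ∀ g → Ex p g ≡ g a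
Within-Ex ret    g = refl
Within-Ex (op w) g = Within-Ex w g

Within-meanCost : ∀ {k A c} {p : Prog k A} {a} → Within c p a → meanCost p ℚ.≤ ι c
Within-meanCost {c = c} ret = 0≤ι c
Within-meanCost {c = suc c} (op w) =
  subst (_ ℚ.≤_) (sym (ι-+ 1 c)) (ℚ.+-monoʳ-≤ 1ℚ (Within-meanCost w))

-- The state of anticipated rejection, `nothing` after a rejection.
State : ℕ → Set
State k = Maybe (Path k × ℤ)

next : ∀ {k} → Step k → State k → State k
next s nothing        = nothing
next s (just (P , h)) =
  if does (h ℤ.+ encode s ℤ.<? 0ℤ) then nothing else just (s ∷ P , h ℤ.+ encode s)

initial : ∀ {k} → State k
initial = just ([] , 0ℤ)

-- The state after the steps of R, the last one first.
state : ∀ {k} → Path k → State k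
state []      = initial
state (s ∷ R) = next s (state R)

Exᶠ : ∀ {k} → ℕ → State k → (State k → ℚ) → ℚ
Exᶠ m nothing        g = g nothing
Exᶠ m (just (P , h)) g = Ex (florentine m P h) g

Exᶠ-zero : ∀ {k} (x : State k) {g} → Exᶠ 0 x g ≡ g x
Exᶠ-zero nothing  = refl
Exᶠ-zero (just _) = refl

Exᶠ-first : ∀ {k} m (x : State k) {g} → Exᶠ (suc m) x g ≡ mean k (λ s → Exᶠ m (next s x) g)
Exᶠ-first {k} m nothing        = sym (mean-const k _)
Exᶠ-first {k} m (just (P , h)) {g} = mean-cong k λ s → branch s (does (h ℤ.+ encode s ℤ.<? 0ℤ))
  where
  branch : ∀ s b →
    Ex (if b then ret nothing else (⟨ s ∷ P ⟩ >>= λ P′ → florentine m P′ (h ℤ.+ encode s))) g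
    ≡ Exᶠ m (if b then nothing else just (s ∷ P , h ℤ.+ encode s)) g
  branch s true  = refl
  branch s false = refl

-- `florentine` exposes its first draw, whereas `state` takes the last step off first. Exchanging
-- two independent draws by `mean-swap` turns the recursion around.
Exᶠ-last : ∀ {k} m (x : State k) {g} → Exᶠ (suc m) x g ≡ mean k (λ s → Exᶠ m x (g ∘ next s))
Exᶠ-last {k} zero x {g} = trans (Exᶠ-first 0 x)
  (mean-cong k (λ s → trans (Exᶠ-zero (next s x)) (sym (Exᶠ-zero x))))
Exᶠ-last {k} (suc m) x {g} = begin
  Exᶠ {k} (suc (suc m)) x g                                      ≡⟨ Exᶠ-first {k} (suc m) x ⟩
  mean k (λ s → Exᶠ (suc m) (next s x) g)                        ≡⟨ mean-cong k (λ s → Exᶠ-last m (next s x)) ⟩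
  mean k (λ s → mean k (λ t → Exᶠ m (next s x) (g ∘ next t)))    ≡⟨ mean-swap k {λ s t → Exᶠ m (next s x) (g ∘ next t)} ⟩
  mean k (λ t → mean k (λ s → Exᶠ m (next s x) (g ∘ next t)))    ≡⟨ mean-cong k (λ t → Exᶠ-first m x) ⟨
  mean k (λ t → Exᶠ (suc m) x (g ∘ next t))                      ∎
  where open ≡-Reasoning

weight : ℕ → ℕ → ℚ
weight k zero    = 1ℚ
weight k (suc n) = inv k ℚ.* weight k n

weight-ι : ∀ k n → weight k n ℚ.* ι ((2 + k) ^ n) ≡ 1ℚ
weight-ι k zero    = refl
weight-ι k (suc n) = begin
  inv k ℚ.* weight k n ℚ.* ι ((2 + k) * (2 + k) ^ n)
    ≡⟨ cong (inv k ℚ.* weight k n ℚ.*_) (ι-* (2 + k) ((2 + k) ^ n)) ⟩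
  inv k ℚ.* weight k n ℚ.* (ι (2 + k) ℚ.* ι ((2 + k) ^ n))
    ≡⟨ solve 4 (λ a b c d → a :* b :* (c :* d) := a :* c :* (b :* d)) refl (inv k) _ _ _ ⟩
  inv k ℚ.* ι (2 + k) ℚ.* (weight k n ℚ.* ι ((2 + k) ^ n))
    ≡⟨ cong₂ ℚ._*_ (inv-ι k) (weight-ι k n) ⟩
  1ℚ ∎
  where
  open ≡-Reasoning
  open +-*-Solver

weight-pos : ∀ k n → ℚ.Positive (weight k n)
weight-pos k zero    = _
weight-pos k (suc n) = ℚ.pos*pos⇒pos (inv k) {{ℚ.normalize-pos 1 (2 + k)}} (weight k n) {{weight-pos k n}}

-- A rejected state absorbs all further steps, so a run may be imagined to go on drawing until n
-- steps are reached. It then becomes a plain average over all (k + 2)^n words.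
Exᶠ-words : ∀ {k} n {g : State k → ℚ} →
  Exᶠ n initial g ≡ weight k n ℚ.* ∑ᴿ (words k n) (g ∘ state)
Exᶠ-words zero {g} = sym (trans (ℚ.*-identityˡ _) (ℚ.+-identityʳ _))
Exᶠ-words {k} (suc n) {g} = begin
  Exᶠ {k} (suc n) initial g                    ≡⟨ Exᶠ-last {k} n initial ⟩
  mean k (λ s → Exᶠ n initial (g ∘ next s))    ≡⟨ mean-cong k (λ s → Exᶠ-words n {g ∘ next s}) ⟩
  mean k (λ s → weight k n ℚ.* ∑ᴿ (words k n) (g ∘ next s ∘ state))
    ≡⟨ mean-* k (weight k n) (λ s → ∑ᴿ (words k n) (g ∘ next s ∘ state)) ⟩
  weight k n ℚ.* mean k (λ s → ∑ᴿ (words k n) (g ∘ next s ∘ state))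
    ≡⟨ *-swap (weight k n) (inv k) _ ⟩
  inv k ℚ.* (weight k n ℚ.* ∑ᴿ (steps k) (λ s → ∑ᴿ (words k n) (g ∘ next s ∘ state)))
    ≡⟨ cong (λ x → inv k ℚ.* (weight k n ℚ.* x)) (∑ᴿ-words {k} n {g ∘ state}) ⟨
  inv k ℚ.* (weight k n ℚ.* ∑ᴿ (words k (suc n)) (g ∘ state))
    ≡⟨ ℚ.*-assoc (inv k) (weight k n) _ ⟨
  weight k (suc n) ℚ.* ∑ᴿ (words k (suc n)) (g ∘ state) ∎
  where open ≡-Reasoning

alive : ∀ {A : Set} → Maybe A → ℕ
alive nothing  = 0
alive (just _) = 1

-- Expected number of states other than `nothing` among the first m + 1.
lifetime : ∀ {k} → ℕ → State k → ℚ
lifetime zero    x = Exᶠ 0 x (ι ∘ alive)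
lifetime (suc m) x = lifetime m x ℚ.+ Exᶠ (suc m) x (ι ∘ alive)

lifetime-first : ∀ {k} m (x : State k) →
  lifetime (suc m) x ≡ ι (alive x) ℚ.+ mean k (λ s → lifetime m (next s x))
lifetime-first zero    x = cong₂ ℚ._+_ (Exᶠ-zero x) (Exᶠ-first 0 x)
lifetime-first {k} (suc m) x = begin
  lifetime (suc m) x ℚ.+ Exᶠ (suc (suc m)) x (ι ∘ alive)
    ≡⟨ cong₂ ℚ._+_ (lifetime-first m x) (Exᶠ-first (suc m) x) ⟩
  ι (alive x) ℚ.+ mean k (λ s → lifetime m (next s x)) ℚ.+ mean k (λ s → Exᶠ (suc m) (next s x) (ι ∘ alive))
    ≡⟨ ℚ.+-assoc (ι (alive x)) _ _ ⟩
  ι (alive x) ℚ.+ (mean k (λ s → lifetime m (next s x)) ℚ.+ mean k (λ s → Exᶠ (suc m) (next s x) (ι ∘ alive)))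
    ≡⟨ cong (λ y → ι (alive x) ℚ.+ y) (mean-+ k (λ s → lifetime m (next s x)) (λ s → Exᶠ (suc m) (next s x) (ι ∘ alive))) ⟨
  ι (alive x) ℚ.+ mean k (λ s → lifetime (suc m) (next s x)) ∎
  where open ≡-Reasoning

lifetime-nothing : ∀ {k} m → lifetime {k} m nothing ≡ 0ℚ
lifetime-nothing zero    = refl
lifetime-nothing (suc m) = cong (ℚ._+ 0ℚ) (lifetime-nothing m)

-- Each state still alive pays for the attempt to extend it: at most six operations, the draw
-- included, whether or not the new step is rejected.
florentine-cost : ∀ {k} m (P : Path k) h →
  meanCost (florentine m P h) ℚ.≤ ι 6 ℚ.* lifetime m (just (P , h))
florentine-cost zero P h = ℚ.*≤* (ℤ.+≤+ (s≤s z≤n))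
florentine-cost {k} (suc m) P h = begin
  1ℚ ℚ.+ (1ℚ ℚ.+ mean k (λ s → 1ℚ ℚ.+ (1ℚ ℚ.+ (1ℚ ℚ.+ meanCost (tail s (does (h ℤ.+ encode s ℤ.<? 0ℤ)))))))
    ≤⟨ ℚ.+-monoʳ-≤ 1ℚ (ℚ.+-monoʳ-≤ 1ℚ (mean-mono k (λ s → branch s (does (h ℤ.+ encode s ℤ.<? 0ℤ))))) ⟩
  1ℚ ℚ.+ (1ℚ ℚ.+ mean k (λ s → ι 4 ℚ.+ ι 6 ℚ.* L s))
    ≡⟨ cong (λ x → 1ℚ ℚ.+ (1ℚ ℚ.+ x)) (trans (mean-+ k (λ _ → ι 4) (λ s → ι 6 ℚ.* L s))
           (cong₂ ℚ._+_ (mean-const k (ι 4)) (mean-* k (ι 6) L))) ⟩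
  1ℚ ℚ.+ (1ℚ ℚ.+ (ι 4 ℚ.+ ι 6 ℚ.* mean k L))
    ≡⟨ solve 1 (λ x → con 1ℚ :+ (con 1ℚ :+ (con (ι 4) :+ con (ι 6) :* x)) := con (ι 6) :* (con 1ℚ :+ x)) refl (mean k L) ⟩
  ι 6 ℚ.* (ι 1 ℚ.+ mean k L)
    ≡⟨ cong (ι 6 ℚ.*_) (lifetime-first m (just (P , h))) ⟨
  ι 6 ℚ.* lifetime (suc m) (just (P , h)) ∎
  where
  open ℚ.≤-Reasoning
  open +-*-Solver
  tail : Step k → Bool → Prog k (State k)
  tail s b = if b then ret nothing else (⟨ s ∷ P ⟩ >>= λ P′ → florentine m P′ (h ℤ.+ encode s))
  L : Step k → ℚ
  L s = lifetime m (next s (just (P , h)))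
  branch : ∀ s b → 1ℚ ℚ.+ (1ℚ ℚ.+ (1ℚ ℚ.+ meanCost (tail s b)))
    ℚ.≤ ι 4 ℚ.+ ι 6 ℚ.* lifetime m (if b then nothing else just (s ∷ P , h ℤ.+ encode s))
  branch s true rewrite lifetime-nothing {k} m = ℚ.*≤* (ℤ.+≤+ (s≤s (s≤s (s≤s z≤n))))
  branch s false = begin
    1ℚ ℚ.+ (1ℚ ℚ.+ (1ℚ ℚ.+ (1ℚ ℚ.+ c)))
      ≡⟨ solve 1 (λ c → con 1ℚ :+ (con 1ℚ :+ (con 1ℚ :+ (con 1ℚ :+ c))) := con (ι 4) :+ c) refl c ⟩
    ι 4 ℚ.+ c  ≤⟨ ℚ.+-monoʳ-≤ (ι 4) (florentine-cost m (s ∷ P) (h ℤ.+ encode s)) ⟩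
    _ ∎
    where c = meanCost (florentine m (s ∷ P) (h ℤ.+ encode s))

survivors : ∀ k → ℕ → ℕ
survivors k n = ∑ (words k n) (alive ∘ state)

-- (k + 2)^n times the expected number of steps survived.
survived : ∀ k → ℕ → ℕ
survived k zero    = survivors k 0
survived k (suc n) = (2 + k) * survived k n + survivors k (suc n)

Exᶠ-ι : ∀ {k} n (f : State k → ℕ) →
  Exᶠ n initial (ι ∘ f) ≡ weight k n ℚ.* ι (∑ (words k n) (f ∘ state))
Exᶠ-ι {k} n f = trans (Exᶠ-words n) (cong (weight k n ℚ.*_) (∑-ι (words k n) {f ∘ state}))

lifetime-survived : ∀ k n → lifetime {k} n initial ≡ weight k n ℚ.* ι (survived k n)
lifetime-survived k zero    = refl
lifetime-survived k (suc n) = begin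
  lifetime {k} n initial ℚ.+ Exᶠ {k} (suc n) initial (ι ∘ alive)
    ≡⟨ cong₂ ℚ._+_ (lifetime-survived k n) (Exᶠ-ι {k} (suc n) alive) ⟩
  weight k n ℚ.* ι (survived k n) ℚ.+ weight k (suc n) ℚ.* ι (survivors k (suc n))
    ≡⟨ cong (ℚ._+ weight k (suc n) ℚ.* ι (survivors k (suc n))) scale ⟩
  weight k (suc n) ℚ.* ι ((2 + k) * survived k n) ℚ.+ weight k (suc n) ℚ.* ι (survivors k (suc n))
    ≡⟨ ℚ.*-distribˡ-+ (weight k (suc n)) (ι ((2 + k) * survived k n)) (ι (survivors k (suc n))) ⟨
  weight k (suc n) ℚ.* (ι ((2 + k) * survived k n) ℚ.+ ι (survivors k (suc n)))
    ≡⟨ cong (weight k (suc n) ℚ.*_) (ι-+ ((2 + k) * survived k n) (survivors k (suc n))) ⟨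
  weight k (suc n) ℚ.* ι (survived k (suc n)) ∎
  where
  open ≡-Reasoning
  open +-*-Solver
  scale : weight k n ℚ.* ι (survived k n) ≡ weight k (suc n) ℚ.* ι ((2 + k) * survived k n)
  scale = begin
    weight k n ℚ.* ι (survived k n)            ≡⟨ ℚ.*-identityˡ _ ⟨
    1ℚ ℚ.* (weight k n ℚ.* ι (survived k n))   ≡⟨ cong (ℚ._* (weight k n ℚ.* ι (survived k n))) (inv-ι k) ⟨
    inv k ℚ.* ι (2 + k) ℚ.* (weight k n ℚ.* ι (survived k n))
      ≡⟨ solve 4 (λ a c b d → a :* c :* (b :* d) := a :* b :* (c :* d)) refl (inv k) (ι (2 + k)) (weight k n) _ ⟩
    inv k ℚ.* weight k n ℚ.* (ι (2 + k) ℚ.* ι (survived k n))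
      ≡⟨ cong (weight k (suc n) ℚ.*_) (ι-* (2 + k) (survived k n)) ⟨
    weight k (suc n) ℚ.* ι ((2 + k) * survived k n) ∎

-- Counting prefixes

unique-length : ∀ {A : Set} {xs ys : List A} → Unique xs → Unique ys →
  (∀ {x} → x ∈ xs → x ∈ ys) → (∀ {x} → x ∈ ys → x ∈ xs) → length xs ≡ length ys
unique-length u v f g = ↭-length (∼bag⇒↭ (unique∧set⇒bag u v (mk⇔ f g)))

indicator : ∀ {P : Set} → Dec P → ℕ
indicator d = if does d then 1 else 0

∑-indicator : ∀ {A : Set} {P : A → Set} (P? : Decidable P) xs →
  ∑ xs (indicator ∘ P?) ≡ length (filter P? xs)
∑-indicator P? []       = refl
∑-indicator P? (x ∷ xs) with P? x
... | yes _ = cong suc (∑-indicator P? xs)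
... | no _  = ∑-indicator P? xs

private
  words≡ : ∀ {k} (xs : List (Step k)) (ys : List (Path k)) →
    concatMap (λ s → map (s ∷_) ys) xs ≡ cartesianProductWith _∷_ xs ys
  words≡ []       ys = refl
  words≡ (x ∷ xs) ys = cong (map (x ∷_) ys ++_) (words≡ xs ys)

∈-steps : ∀ {k} (s : Step k) → s ∈ steps k
∈-steps rise     = here refl
∈-steps fall     = there (here refl)
∈-steps (flat c) = there (there (∈-map⁺ flat (∈-allFin c)))

steps-unique : ∀ k → Unique (steps k)
steps-unique k =
  ((λ ()) ∷ All.map⁺ (All.tabulate λ _ ())) ∷
  All.map⁺ (All.tabulate λ _ ()) ∷
  Unique.map⁺ (λ { refl → refl }) (Unique.allFin⁺ k)

∈-words⁺ : ∀ {k} (R : Path k) → R ∈ words k (length R)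
∈-words⁺ []      = here refl
∈-words⁺ {k} (s ∷ R) = subst (s ∷ R ∈_) (sym (words≡ (steps k) (words k (length R))))
  (∈-cartesianProductWith⁺ _∷_ (∈-steps s) (∈-words⁺ R))

∈-words⁻ : ∀ {k} n {R : Path k} → R ∈ words k n → length R ≡ n
∈-words⁻ zero (here refl) = refl
∈-words⁻ {k} (suc n) R∈
  with ∈-cartesianProductWith⁻ _∷_ (steps k) (words k n)
         (subst (_ ∈_) (words≡ (steps k) (words k n)) R∈)
... | s , R , _ , R∈′ , refl = cong suc (∈-words⁻ n R∈′)

words-unique : ∀ k n → Unique (words k n)
words-unique k zero    = [] ∷ []
words-unique k (suc n) = subst Unique (sym (words≡ (steps k) (words k n)))
  (Unique.cartesianProductWith⁺ _∷_ List.∷-injective (steps-unique k) (words-unique k n))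

-- Integer ordinates and natural-number heights

private
  head≥0 : ∀ {k h} (P : Path k) → All (0ℤ ℤ.≤_) (ordinates h P) → 0ℤ ℤ.≤ h
  head≥0 []      (x ∷ _) = x
  head≥0 (_ ∷ _) (x ∷ _) = x

  h+0 : ∀ h → + h ℤ.+ 0ℤ ≡ + h
  h+0 h = ℤ.+-identityʳ (+ h)

  Nonneg : ∀ {k} → Path k → ℤ → Set
  Nonneg P h = All (0ℤ ℤ.≤_) (ordinates h P)

Down-from : ∀ {k} h (P : Path k) → All (0ℤ ℤ.≤_) (ordinates (+ h) P) →
  + h ℤ.+ finalHeight P ≡ 0ℤ → Down P h
Down-from h []           _         eq with refl ← trans (sym (h+0 h)) eq = []
Down-from h (rise ∷ P)   (_ ∷ ge)  eq = rise (Down-from (suc h) P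
  (subst (Nonneg P) (+[n+1] h) ge)
  (trans (cong (λ x → x ℤ.+ finalHeight P) (sym (+[n+1] h))) (trans (ℤ.+-assoc (+ h) 1ℤ (finalHeight P)) eq)))
Down-from zero    (fall ∷ P) (_ ∷ ge) eq with () ← head≥0 P ge
Down-from (suc h) (fall ∷ P) (_ ∷ ge) eq = fall (Down-from h P ge
  (trans (ℤ.+-assoc (+ suc h) -1ℤ (finalHeight P)) eq))
Down-from h (flat c ∷ P) (_ ∷ ge) eq = flat (Down-from h P
  (subst (Nonneg P) (h+0 h) ge)
  (trans (cong (λ x → + h ℤ.+ x) (sym (ℤ.+-identityˡ (finalHeight P)))) eq))

Down-to : ∀ {k h} {P : Path k} → Down P h →
  All (0ℤ ℤ.≤_) (ordinates (+ h) P) × + h ℤ.+ finalHeight P ≡ 0ℤ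
Down-to [] = ℤ.+≤+ z≤n ∷ [] , refl
Down-to {h = h} {rise ∷ P} (rise d) with Down-to d
... | ge , eq = ℤ.+≤+ z≤n ∷ subst (Nonneg P) (sym (+[n+1] h)) ge ,
  trans (sym (ℤ.+-assoc (+ h) 1ℤ (finalHeight P))) (trans (cong (λ x → x ℤ.+ finalHeight P) (+[n+1] h)) eq)
Down-to {h = suc h} {fall ∷ P} (fall d) with Down-to d
... | ge , eq = ℤ.+≤+ z≤n ∷ ge , trans (sym (ℤ.+-assoc (+ suc h) -1ℤ (finalHeight P))) eq
Down-to {h = h} {flat c ∷ P} (flat d) with Down-to d
... | ge , eq = ℤ.+≤+ z≤n ∷ subst (Nonneg P) (sym (h+0 h)) ge ,
  trans (cong (λ x → + h ℤ.+ x) (ℤ.+-identityˡ (finalHeight P))) eq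

IsMotzkin⇒Down : ∀ {k} {P : Path k} → IsMotzkin P → Down P 0
IsMotzkin⇒Down {P = P} (ge , eq) = Down-from 0 P ge (trans (ℤ.+-identityˡ (finalHeight P)) eq)

Down⇒IsMotzkin : ∀ {k} {P : Path k} → Down P 0 → IsMotzkin P
Down⇒IsMotzkin {P = P} d with Down-to d
... | ge , eq = ge , trans (sym (ℤ.+-identityˡ (finalHeight P))) eq

∈-motzkinPaths⁺ : ∀ {k} {w : Path k} → Down w 0 → w ∈ motzkinPaths k (length w)
∈-motzkinPaths⁺ {w = w} d = ∈-filter⁺ isMotzkin? (∈-words⁺ w) (Down⇒IsMotzkin d)

∈-motzkinPaths⁻ : ∀ {k n} {w : Path k} → w ∈ motzkinPaths k n → Down w 0 × length w ≡ n
∈-motzkinPaths⁻ {k} {n} w∈ with ∈-filter⁻ isMotzkin? {xs = words k n} w∈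
... | w∈′ , m = IsMotzkin⇒Down m , ∈-words⁻ n w∈′

motzkinPaths-unique : ∀ k n → Unique (motzkinPaths k n)
motzkinPaths-unique k n = Unique.filter⁺ isMotzkin? (words-unique k n)

Down-ʳ++ : ∀ {k} {P R : Path k} {h} → Up R h → Down P h → Up (P ʳ++ R) 0
Down-ʳ++ u []       = u
Down-ʳ++ u (rise d) = Down-ʳ++ (rise u) d
Down-ʳ++ u (fall d) = Down-ʳ++ (fall u) d
Down-ʳ++ u (flat d) = Down-ʳ++ (flat u) d

Up-state : ∀ {k} {R : Path k} {h} → Up R h → state R ≡ just (R , + h)
Up-state [] = refl
Up-state {R = rise ∷ R} {suc h} (rise u) rewrite Up-state u =
  cong (λ n → just (rise ∷ R , + n)) (ℕ.+-comm h 1)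
Up-state (fall u) rewrite Up-state u = refl
Up-state {R = flat c ∷ R} {h} (flat u) rewrite Up-state u =
  cong (λ n → just (flat c ∷ R , + n)) (ℕ.+-identityʳ h)

Up? : ∀ {k} (R : Path k) → state R ≡ nothing ⊎ ∃ (Up R)
Up? [] = inj₂ (0 , [])
Up? (s ∷ R) with Up? R
... | inj₁ eq = inj₁ (cong (next s) eq)
Up? (rise ∷ R)   | inj₂ (h , u)     = inj₂ (suc h , rise u)
Up? (fall ∷ R)   | inj₂ (zero , u)  = inj₁ (cong (next fall) (Up-state u))
Up? (fall ∷ R)   | inj₂ (suc h , u) = inj₂ (h , fall u)
Up? (flat c ∷ R) | inj₂ (h , u)     = inj₂ (h , flat u)

-- The absolute value is only a cast, since the height of a surviving state is never negative.
atHeight : ∀ {k} → (ℕ → ℕ) → State k → ℕ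
atHeight φ nothing        = 0
atHeight φ (just (_ , h)) = φ ℤ.∣ h ∣

atHeight-Up : ∀ {k} φ {R : Path k} {h} → Up R h → atHeight φ (state R) ≡ φ h
atHeight-Up φ u = cong (atHeight φ) (Up-state u)

-- Total of φ (final height) over the prefixes of length n.
count : ∀ k → (ℕ → ℕ) → ℕ → ℕ
count k φ n = ∑ (words k n) (atHeight φ ∘ state)

-- The contribution of a fall from the given height; from height 0 it leads to rejection and
-- contributes nothing.
below : (ℕ → ℕ) → ℕ → ℕ
below φ zero    = 0
below φ (suc h) = φ h

∑-next : ∀ {k} φ {R : Path k} {h} → Up R h →
  ∑ (steps k) (λ s → atHeight φ (state (s ∷ R))) ≡ φ (suc h) + (below φ h + k * φ h)
∑-next {k} φ {R} {h} u = cong₂ _+_ (atHeight-Up φ (rise u)) (cong₂ _+_ (falls u) (begin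
  ∑ (map flat (allFin k)) (λ s → atHeight φ (state (s ∷ R)))  ≡⟨ ∑-map flat (allFin k) ⟩
  ∑ (allFin k) (λ c → atHeight φ (state (flat c ∷ R)))        ≡⟨ ∑-cong (allFin k) (λ c → atHeight-Up φ (flat {c = c} u)) ⟩
  ∑ (allFin k) (λ _ → φ h)                                    ≡⟨ ∑-const (allFin k) (φ h) ⟩
  length (allFin k) * φ h                                     ≡⟨ cong (_* φ h) (List.length-tabulate {n = k} (λ i → i)) ⟩
  k * φ h                                                     ∎))
  where
  open ≡-Reasoning
  falls : ∀ {h} → Up R h → atHeight φ (state (fall ∷ R)) ≡ below φ h
  falls {zero}  u rewrite Up-state u = refl
  falls {suc h} u = atHeight-Up φ (fall u)

-- Removing the last step reduces a recurrence for the counts to an identity at each height. The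
-- term ψ stands on the left because it corrects for the falls lost at height 0, which would
-- otherwise be subtracted.
count-step : ∀ {k} {φ ψ χ : ℕ → ℕ} → (∀ h → φ (suc h) + (below φ h + k * φ h) + ψ h ≡ χ h) →
  ∀ n → count k φ (suc n) + count k ψ n ≡ count k χ n
count-step {k} {φ} {ψ} {χ} eq n = begin
  count k φ (suc n) + count k ψ n
    ≡⟨ cong (_+ count k ψ n) (trans (∑-words {k} n) (∑-swap (steps k) (words k n))) ⟩
  ∑ (words k n) (λ R → ∑ (steps k) (λ s → atHeight φ (state (s ∷ R)))) + count k ψ n
    ≡⟨ ∑-∙ (words k n) ⟨
  ∑ (words k n) (λ R → ∑ (steps k) (λ s → atHeight φ (state (s ∷ R))) + atHeight ψ (state R))
    ≡⟨ ∑-cong (words k n) pointwise ⟩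
  count k χ n ∎
  where
  open ≡-Reasoning
  pointwise : ∀ R → ∑ (steps k) (λ s → atHeight φ (state (s ∷ R))) + atHeight ψ (state R)
              ≡ atHeight χ (state R)
  pointwise R with Up? R
  ... | inj₁ dead rewrite dead = trans (ℕ.+-identityʳ _) (∑-ε (steps k))
  ... | inj₂ (h , u) =
    trans (cong₂ _+_ (∑-next φ u) (atHeight-Up ψ u)) (trans (eq h) (sym (atHeight-Up χ u)))

count-+ : ∀ k {φ ψ : ℕ → ℕ} n → count k (λ h → φ h + ψ h) n ≡ count k φ n + count k ψ n
count-+ k {φ} {ψ} n = trans (∑-cong (words k n) (λ R → pointwise (state R))) (∑-∙ (words k n))
  where
  pointwise : ∀ x → atHeight (λ h → φ h + ψ h) x ≡ atHeight φ x + atHeight ψ x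
  pointwise nothing  = refl
  pointwise (just _) = refl

count-* : ∀ k c {φ : ℕ → ℕ} n → count k (λ h → c * φ h) n ≡ c * count k φ n
count-* k c {φ} n = trans (∑-cong (words k n) (λ R → pointwise (state R))) (∑-* (words k n) c)
  where
  pointwise : ∀ x → atHeight (λ h → c * φ h) x ≡ c * atHeight φ x
  pointwise nothing  = sym (ℕ.*-zeroʳ c)
  pointwise (just _) = refl

one isZero : ℕ → ℕ
one _ = 1
isZero zero    = 1
isZero (suc _) = 0

isEven isOdd : ℕ → ℕ
isEven zero    = 1
isEven (suc n) = isOdd n
isOdd zero     = 0
isOdd (suc n)  = isEven n

survivors-step : ∀ k n → count k one (suc n) + count k isZero n ≡ (2 + k) * count k one n
survivors-step k n = trans (count-step {φ = one} {isZero} {λ _ → (2 + k) * 1} identity n) (count-* k (2 + k) {one} n)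
  where
  identity : ∀ h → 1 + (below one h + k * 1) + isZero h ≡ (2 + k) * 1
  identity zero    = lemma k
    where
    lemma : ∀ k → 1 + (0 + k * 1) + 1 ≡ (2 + k) * 1
    lemma = solve-∀
  identity (suc h) = ℕ.+-identityʳ _

-- An odd height keeps its parity through the k flat steps. An even height becomes odd by a rise or
-- a fall, except that at height 0 the fall is lost.
odd-step : ∀ k n → count k isOdd (suc n) + count k isZero n ≡ k * count k isOdd n + 2 * count k isEven n
odd-step k n = begin
  count k isOdd (suc n) + count k isZero n
    ≡⟨ count-step {φ = isOdd} {isZero} {λ h → k * isOdd h + 2 * isEven h} identity n ⟩
  count k (λ h → k * isOdd h + 2 * isEven h) n
    ≡⟨ count-+ k {λ h → k * isOdd h} {λ h → 2 * isEven h} n ⟩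
  count k (λ h → k * isOdd h) n + count k (λ h → 2 * isEven h) n
    ≡⟨ cong₂ _+_ (count-* k k {isOdd} n) (count-* k 2 {isEven} n) ⟩
  k * count k isOdd n + 2 * count k isEven n ∎
  where
  open ≡-Reasoning
  identity : ∀ h → isEven h + (below isOdd h + k * isOdd h) + isZero h ≡ k * isOdd h + 2 * isEven h
  identity zero    = lemma k
    where
    lemma : ∀ k → 1 + (0 + k * 0) + 1 ≡ k * 0 + 2 * 1
    lemma = solve-∀
  identity (suc h) = lemma k (isOdd h) (isEven h)
    where
    lemma : ∀ k o e → o + (o + k * e) + 0 ≡ k * e + 2 * o
    lemma = solve-∀

odd+even : ∀ k n → count k isOdd n + count k isEven n ≡ count k one n
odd+even k n = trans (sym (count-+ k {isOdd} {isEven} n)) (∑-cong (words k n) (λ R → pointwise (state R)))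
  where
  parity : ∀ h → isOdd h + isEven h ≡ 1
  parity zero    = refl
  parity (suc h) = trans (ℕ.+-comm (isEven h) (isOdd h)) (parity h)
  pointwise : ∀ x → atHeight (λ h → isOdd h + isEven h) x ≡ atHeight one x
  pointwise nothing        = refl
  pointwise (just (_ , h)) = parity ℤ.∣ h ∣

survivors≡ : ∀ k n → survivors k n ≡ count k one n
survivors≡ k n = ∑-cong (words k n) (λ R → pointwise (state R))
  where
  pointwise : ∀ x → alive x ≡ atHeight one x
  pointwise nothing  = refl
  pointwise (just _) = refl

isZero-indicator : ∀ {k} (x : State k) → atHeight isZero x ≡ indicator (atHeight isZero x ℕ.≟ 1)
isZero-indicator nothing              = refl
isZero-indicator (just (_ , + zero))   = refl
isZero-indicator (just (_ , + suc _))  = refl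
isZero-indicator (just (_ , -[1+ _ ])) = refl

-- Words are counted with their last step first, so Motzkin paths appear here reversed.
returns : ∀ k n → count k isZero n ≡ length (motzkinPaths k n)
returns k n = begin
  count k isZero n                             ≡⟨ ∑-cong (words k n) (isZero-indicator ∘ state) ⟩
  ∑ (words k n) (indicator ∘ zero?)            ≡⟨ ∑-indicator zero? (words k n) ⟩
  length (filter zero? (words k n))
    ≡⟨ unique-length (Unique.filter⁺ zero? (words-unique k n))
         (Unique.map⁺ List.reverse-injective (motzkinPaths-unique k n)) to from ⟩
  length (map reverse (motzkinPaths k n))      ≡⟨ List.length-map reverse (motzkinPaths k n) ⟩
  length (motzkinPaths k n)                    ∎
  where
  open ≡-Reasoning
  zero? : Decidable (λ R → atHeight isZero (state R) ≡ 1)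
  zero? R = atHeight isZero (state R) ℕ.≟ 1
  to : ∀ {R} → R ∈ filter zero? (words k n) → R ∈ map reverse (motzkinPaths k n)
  to {R} R∈ with ∈-filter⁻ zero? {xs = words k n} R∈
  ... | R∈′ , eq with Up? R
  ... | inj₁ dead with () ← trans (sym eq) (cong (atHeight isZero) dead)
  ... | inj₂ (suc h , u) with () ← trans (sym eq) (atHeight-Up isZero u)
  ... | inj₂ (zero , u) = subst (_∈ map reverse (motzkinPaths k n)) (List.reverse-involutive R)
    (∈-map⁺ reverse (subst (λ m → reverse R ∈ motzkinPaths k m)
      (trans (List.length-reverse R) (∈-words⁻ n R∈′)) (∈-motzkinPaths⁺ (Up-ʳ++ u []))))
  from : ∀ {R} → R ∈ map reverse (motzkinPaths k n) → R ∈ filter zero? (words k n)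
  from R∈ with ∈-map⁻ reverse R∈
  ... | w , w∈ , refl with ∈-motzkinPaths⁻ {n = n} w∈
  ... | d , refl = ∈-filter⁺ zero?
    (subst (λ m → reverse w ∈ words k m) (List.length-reverse w) (∈-words⁺ (reverse w)))
    (atHeight-Up isZero (Down-ʳ++ [] d))

-- Outcomes of prefixes and preimages of outputs

data Outcome {k} (R : Path k) : Set where
  dead : state R ≡ nothing → Outcome R
  even : ∀ i → Up R (i + i) → Outcome R
  odd  : ∀ i S T → R ≡ S ++ rise ∷ T → Up S i → Up T i → Outcome R

half? : ∀ h → (∃[ i ] h ≡ i + i) ⊎ (∃[ i ] h ≡ suc (i + i))
half? zero = inj₁ (0 , refl)
half? (suc h) with half? h
... | inj₁ (i , refl) = inj₂ (i , refl)
... | inj₂ (i , refl) = inj₁ (suc i , cong suc (sym (ℕ.+-suc i i)))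

outcome : ∀ {k} (R : Path k) → Outcome R
outcome R with Up? R
... | inj₁ eq = dead eq
... | inj₂ (h , u) with half? h
... | inj₁ (i , refl) = even i u
... | inj₂ (i , refl) with split-last-rise i i R (subst (Up R) (sym (ℕ.+-suc i i)) u)
... | S , T , eq , v , w = odd i S T eq v w

result : ∀ {k} {R : Path k} → Outcome R → Maybe (Path k)
result (dead _)          = nothing
result (even _ _)        = nothing
result (odd _ S T _ _ _) = just (rotate S T)

isOdd-even : ∀ i → isOdd (i + i) ≡ 0
isOdd-even zero    = refl
isOdd-even (suc i) = trans (cong isEven (ℕ.+-suc i i)) (isOdd-even i)

isEven-even : ∀ i → isEven (i + i) ≡ 1
isEven-even zero    = refl
isEven-even (suc i) = trans (cong isOdd (ℕ.+-suc i i)) (isEven-even i)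

join-Up : ∀ {k} {S T : Path k} {i} → Up S i → Up T i → Up (S ++ rise ∷ T) (suc (i + i))
join-Up {i = i} u v = subst (Up _) (ℕ.+-suc i i) (Up-++ u (rise v))

-- The result does not depend on the classification found: the final height fixes the parity and i,
-- and `split-unique` fixes the two pieces.
result-split : ∀ {k} {S T : Path k} {i} → Up S i → Up T i → (o : Outcome (S ++ rise ∷ T)) →
  result o ≡ just (rotate S T)
result-split u v (dead eq) with () ← trans (sym eq) (Up-state (join-Up u v))
result-split {i = i} u v (even j w)
  with () ← trans (sym (isEven-even i)) (trans (cong isOdd (Up-unique (join-Up u v) w)) (isOdd-even j))
result-split {S = S} {i = i} u v (odd j S′ T′ eq u′ v′)
  with refl ← double-injective i j (ℕ.suc-injective
         (Up-unique (join-Up u v) (subst (λ R → Up R _) (sym eq) (join-Up u′ v′))))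
  with refl ← split-unique u u′ eq
  with refl ← List.∷-injectiveʳ (List.++-cancelˡ S _ _ eq) = refl

-- The linear part of the cost is charged to odd prefixes only, that is, to successful passes; other
-- survivors pay just for the parity test. The bound therefore sums to multiples of A and O.
fromPrefix-outcome : ∀ {k n} (R : Path k) → length R ≡ suc n →
  Within (2 * alive (state R) + (n * 17 + 25) * atHeight isOdd (state R))
    (fromPrefix n (state R)) (result (outcome R))
fromPrefix-outcome {n = n} R len with outcome R
... | dead eq rewrite eq = ret
... | even i u =
  subst (λ x → Within (2 * alive x + (n * 17 + 25) * atHeight isOdd x) (fromPrefix n x) nothing)
    (sym (Up-state u))
    (weaken (ℕ.m≤m+n 2 _) (fromPrefix-even {n = n} {i} {R}))
... | odd i S T refl u v
  with refl ← ℕ.suc-injective (trans (sym len) (trans (List.length-++ S) (ℕ.+-suc _ _))) =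
  subst (λ x → Within (2 * alive x + (n * 17 + 25) * atHeight isOdd x) (fromPrefix n x) (just (rotate S T)))
    (sym (Up-state (join-Up u v)))
    (weaken cost (fromPrefix-odd u v))
  where
  cost : n * 17 + 25 ≤ 2 * 1 + (n * 17 + 25) * isEven (i + i)
  cost rewrite isEven-even i | ℕ.*-identityʳ (n * 17 + 25) = ℕ.m≤n+m _ 2

_≟ᴹ_ : ∀ {k} (x y : Maybe (Path k)) → Dec (x ≡ y)
_≟ᴹ_ = Maybe.≡-dec _≟ᴾ_

hits : ∀ k → ℕ → Path k → ℕ
hits k n w = ∑ (words k (suc n)) (λ R → indicator (result (outcome R) ≟ᴹ just w))

-- The prefixes that yield w are exactly the `preimage w j` with 0 ≤ j ≤ n, and these are pairwise
-- distinct.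
hits-motzkin : ∀ {k} (w : Path k) → Down w 0 → hits k (length w) w ≡ suc (length w)
hits-motzkin {k} w d = begin
  hits k n w                                  ≡⟨ ∑-indicator hit? (words k (suc n)) ⟩
  length (filter hit? (words k (suc n)))
    ≡⟨ unique-length (Unique.filter⁺ hit? (words-unique k (suc n))) distinct to from ⟩
  length (applyUpTo (preimage w) (suc n))     ≡⟨ List.length-applyUpTo (preimage w) (suc n) ⟩
  suc n                                       ∎
  where
  open ≡-Reasoning
  n = length w
  hit? : Decidable (λ R → result (outcome R) ≡ just w)
  hit? R = result (outcome R) ≟ᴹ just w
  distinct : Unique (applyUpTo (preimage w) (suc n))
  distinct = Unique.applyUpTo⁺₁ (preimage w) (suc n) λ { i<j (s≤s j≤n) eq →
    ℕ.<⇒≢ i<j (preimage-injective d (ℕ.≤-trans (ℕ.<⇒≤ i<j) j≤n) j≤n eq) }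
  to : ∀ {R} → R ∈ filter hit? (words k (suc n)) → R ∈ applyUpTo (preimage w) (suc n)
  to {R} R∈ with ∈-filter⁻ hit? {xs = words k (suc n)} R∈
  ... | _ , eq with outcome R
  to {R} R∈ | _ , refl | odd i S T refl u v =
    subst (_∈ applyUpTo (preimage w) (suc n)) (preimage-rotate u v)
      (∈-applyUpTo⁺ (preimage w) (s≤s (subst (length S ≤_) (sym (rotate-length S T)) (ℕ.m≤m+n _ _))))
  from : ∀ {R} → R ∈ applyUpTo (preimage w) (suc n) → R ∈ filter hit? (words k (suc n))
  from R∈ with ∈-applyUpTo⁻ (preimage w) R∈
  ... | j , _ , refl with Down-split [] d j
  ... | i , u , v = ∈-filter⁺ hit?
    (subst (λ m → preimage w j ∈ words k m) (preimage-length w j) (∈-words⁺ (preimage w j)))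
    (trans (result-split u (unflip-Up 0 {i} 0 [] (subst (Down _) (sym (ℕ.+-identityʳ i)) v)) (outcome _))
      (cong just (rotate-preimage j v)))

result-motzkin : ∀ {k n} {R w : Path k} (o : Outcome R) → length R ≡ suc n → result o ≡ just w →
  w ∈ motzkinPaths k n
result-motzkin {k} {n} (odd i S T refl u v) len refl =
  subst (λ m → rotate S T ∈ motzkinPaths k m)
    (trans (rotate-length S T) (ℕ.suc-injective (trans (sym (ℕ.+-suc _ _)) (trans (sym (List.length-++ S)) len))))
    (∈-motzkinPaths⁺ (rotate-Down u v))

hits-other : ∀ {k} n {w : Path k} → ¬ (w ∈ motzkinPaths k n) → hits k n w ≡ 0
hits-other {k} n {w} w∉ = trans
  (∑-cong-∈ (words k (suc n)) λ {R} R∈ → cong (λ b → if b then 1 else 0)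
    (dec-false (result (outcome R) ≟ᴹ just w) (w∉ ∘ result-motzkin (outcome R) (∈-words⁻ (suc n) R∈))))
  (∑-ε (words k (suc n)))

∑-point : ∀ {k} {x : Path k} {xs} → Unique xs → x ∈ xs → ∑ xs (λ y → indicator (just x ≟ᴹ just y)) ≡ 1
∑-point {x = x} {xs} u x∈ = trans (∑-indicator x? xs)
  (unique-length (Unique.filter⁺ x? u) ([] ∷ []) to from)
  where
  x? : Decidable (λ y → just x ≡ just y)
  x? y = just x ≟ᴹ just y
  to : ∀ {y} → y ∈ filter x? xs → y ∈ x ∷ []
  to y∈ with ∈-filter⁻ x? {xs = xs} y∈
  ... | _ , refl = here refl
  from : ∀ {y} → y ∈ x ∷ [] → y ∈ filter x? xs
  from (here refl) = ∈-filter⁺ x? x∈ refl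

-- Every odd prefix has exactly one output, and every Motzkin path is the output
-- of n + 1 of them.
odd-returns : ∀ k n → count k isOdd (suc n) ≡ suc n * count k isZero n
odd-returns k n = begin
  ∑ (words k (suc n)) (atHeight isOdd ∘ state)
    ≡⟨ ∑-cong-∈ (words k (suc n)) (λ {R} R∈ → pointwise (outcome R) (∈-words⁻ (suc n) R∈)) ⟩
  ∑ (words k (suc n)) (λ R → ∑ M (λ w → indicator (result (outcome R) ≟ᴹ just w)))
    ≡⟨ ∑-swap (words k (suc n)) M ⟩
  ∑ M (hits k n)
    ≡⟨ ∑-cong-∈ M (λ w∈ → each (∈-motzkinPaths⁻ {n = n} w∈)) ⟩
  ∑ M (λ _ → suc n)            ≡⟨ ∑-const M (suc n) ⟩
  length M * suc n             ≡⟨ ℕ.*-comm (length M) (suc n) ⟩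
  suc n * length M             ≡⟨ cong (suc n *_) (returns k n) ⟨
  suc n * count k isZero n     ∎
  where
  open ≡-Reasoning
  M = motzkinPaths k n
  each : ∀ {w} → Down w 0 × length w ≡ n → hits k n w ≡ suc n
  each (d , refl) = hits-motzkin _ d
  pointwise : ∀ {R} (o : Outcome R) → length R ≡ suc n →
    atHeight isOdd (state R) ≡ ∑ M (λ w → indicator (result o ≟ᴹ just w))
  pointwise (dead eq)  len = trans (cong (atHeight isOdd) eq) (sym (∑-ε M))
  pointwise (even i u) len = trans (trans (atHeight-Up isOdd u) (isOdd-even i)) (sym (∑-ε M))
  pointwise o@(odd i S T refl u v) len =
    trans (trans (atHeight-Up isOdd (join-Up u v)) (isEven-even i))
      (sym (∑-point (motzkinPaths-unique k n) (result-motzkin o len refl)))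

-- Inequalities between the counts

returns-bound : ∀ k → 1 ≤ k → ∀ n → (2 + n) * count k isZero n ≤ suc k * count k one n
returns-bound k 1≤k n = begin
  (2 + n) * M              ≡⟨ ℕ.+-comm M (suc n * M) ⟩
  suc n * M + M            ≡⟨ cong (_+ M) (odd-returns k n) ⟨
  count k isOdd (suc n) + M  ≡⟨ odd-step k n ⟩
  -- The hypothesis k ≥ 1 enters as 2 ≤ k + 1.
  k * O + 2 * E            ≤⟨ ℕ.+-mono-≤ (ℕ.*-monoˡ-≤ O (ℕ.n≤1+n k)) (ℕ.*-monoˡ-≤ E (s≤s 1≤k)) ⟩
  suc k * O + suc k * E    ≡⟨ ℕ.*-distribˡ-+ (suc k) O E ⟨
  suc k * (O + E)          ≡⟨ cong (suc k *_) (odd+even k n) ⟩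
  suc k * count k one n    ∎
  where
  open ℕ.≤-Reasoning
  M = count k isZero n
  O = count k isOdd n
  E = count k isEven n

-- The falls lost at height 0 number M_n ≤ (n + 1) M_n = O_{n+1}, so making up for them at most
-- doubles the odd count.
survivors-odd : ∀ k → 1 ≤ k → ∀ n → count k one n ≤ 2 * count k isOdd (suc n)
survivors-odd k 1≤k n = begin
  count k one n            ≡⟨ odd+even k n ⟨
  O + E                    ≤⟨ ℕ.+-mono-≤ (scale O 1≤k) (scale {2} E (s≤s z≤n)) ⟩
  k * O + 2 * E            ≡⟨ odd-step k n ⟨
  O′ + M                   ≤⟨ ℕ.+-monoʳ-≤ O′ (ℕ.m≤m+n M (n * M)) ⟩
  O′ + suc n * M           ≡⟨ cong (λ x → O′ + x) (odd-returns k n) ⟨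
  O′ + O′                  ≡⟨ cong (λ x → O′ + x) (ℕ.+-identityʳ O′) ⟨
  2 * O′                   ∎
  where
  open ℕ.≤-Reasoning
  M = count k isZero n
  O = count k isOdd n
  E = count k isEven n
  O′ = count k isOdd (suc n)
  scale : ∀ {c} m → 1 ≤ c → m ≤ c * m
  scale {c} m 1≤c = subst (_≤ c * m) (ℕ.*-identityˡ m) (ℕ.*-monoˡ-≤ m 1≤c)

survived-bound : ∀ k → 1 ≤ k → ∀ n → survived k n ≤ (2 + k) * (suc n * count k one n)
survived-bound k 1≤k zero = ℕ.m≤m+n 1 _
-- X is what the bound loses through A_{n+1} = K A_n - M_n; adding it to both sides avoids the
-- subtraction.
survived-bound k 1≤k (suc n) = ℕ.+-cancelʳ-≤ X _ _ (begin
  K * survived k n + survivors k (suc n) + X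
    ≡⟨ cong (λ x → K * survived k n + x + X) (survivors≡ k (suc n)) ⟩
  K * survived k n + A′ + X
    ≤⟨ ℕ.+-monoˡ-≤ X (ℕ.+-monoˡ-≤ A′ (ℕ.*-monoʳ-≤ K (survived-bound k 1≤k n))) ⟩
  K * (K * (suc n * A)) + A′ + K * ((2 + n) * M)
    ≤⟨ ℕ.≤-trans (ℕ.m≤m+n _ M) (ℕ.≤-reflexive (arith₁ K n A A′ M)) ⟩
  K * (K * (suc n * A)) + (A′ + M) + K * ((2 + n) * M)
    ≡⟨ cong (λ x → K * (K * (suc n * A)) + x + K * ((2 + n) * M)) (survivors-step k n) ⟩
  K * (K * (suc n * A)) + K * A + K * ((2 + n) * M)
    ≤⟨ ℕ.+-monoʳ-≤ (K * (K * (suc n * A)) + K * A) (ℕ.*-monoʳ-≤ K (returns-bound k 1≤k n)) ⟩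
  K * (K * (suc n * A)) + K * A + K * (suc k * A)
    -- This is an equality because 1 + (k + 1) = K: the new survivors and the bound on X together
    -- make up exactly one more summand K A.
    ≡⟨ arith₂ k n A ⟩
  K * ((2 + n) * (K * A))
    ≡⟨ cong (λ x → K * ((2 + n) * x)) (survivors-step k n) ⟨
  K * ((2 + n) * (A′ + M))
    ≡⟨ arith₃ K n A′ M ⟩
  K * ((2 + n) * A′) + X ∎)
  where
  open ℕ.≤-Reasoning
  K = 2 + k
  A = count k one n
  A′ = count k one (suc n)
  M = count k isZero n
  X = K * ((2 + n) * M)
  arith₁ : ∀ K n A A′ M → K * (K * (suc n * A)) + A′ + K * ((2 + n) * M) + M
    ≡ K * (K * (suc n * A)) + (A′ + M) + K * ((2 + n) * M)
  arith₁ = solve-∀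
  arith₂ : ∀ k n A → (2 + k) * ((2 + k) * (suc n * A)) + (2 + k) * A + (2 + k) * (suc k * A)
    ≡ (2 + k) * ((2 + n) * ((2 + k) * A))
  arith₂ = solve-∀
  arith₃ : ∀ K n A′ M → K * ((2 + n) * (A′ + M)) ≡ K * ((2 + n) * A′) + K * ((2 + n) * M)
  arith₃ = solve-∀

-- Repetition until success

module _ {k A} (p : Prog k (Maybe A)) where

  success : ℚ
  success = Ex p (ι ∘ alive)

  success≤1 : success ℚ.≤ 1ℚ
  success≤1 = subst (success ℚ.≤_) (Ex-const p 1ℚ) (Ex-mono p λ { nothing → 0≤ι 1 ; (just _) → ℚ.≤-refl })

  -- The expression x - x · alive r is x after a failure and 0 after a success. Being linear in the
  -- indicator, its expectation is x times the failure probability.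
  Ex-retry : ∀ (g : Maybe A → ℚ) x → Ex p (λ r → g r ℚ.+ (x ℚ.+ ℚ.- x ℚ.* ι (alive r))) ≡
    Ex p g ℚ.+ (x ℚ.+ ℚ.- x ℚ.* success)
  Ex-retry g x = begin
    Ex p (λ r → g r ℚ.+ (x ℚ.+ ℚ.- x ℚ.* ι (alive r)))
      ≡⟨ Ex-+ p g (λ r → x ℚ.+ ℚ.- x ℚ.* ι (alive r)) ⟩
    Ex p g ℚ.+ Ex p (λ r → x ℚ.+ ℚ.- x ℚ.* ι (alive r))
      ≡⟨ cong (λ y → Ex p g ℚ.+ y) (Ex-+ p (λ _ → x) (λ r → ℚ.- x ℚ.* ι (alive r))) ⟩
    Ex p g ℚ.+ (Ex p (λ _ → x) ℚ.+ Ex p (λ r → ℚ.- x ℚ.* ι (alive r)))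
      ≡⟨ cong (λ y → Ex p g ℚ.+ y) (cong₂ ℚ._+_ (Ex-const p x) (Ex-* p (ℚ.- x) (ι ∘ alive))) ⟩
    Ex p g ℚ.+ (x ℚ.+ ℚ.- x ℚ.* success) ∎
    where open ≡-Reasoning

  private
    dead-branch : ∀ x → x ≡ x ℚ.+ ℚ.- x ℚ.* ι 0
    dead-branch = solve 1 (λ x → x := x :+ :- x :* con 0ℚ) refl
      where open +-*-Solver

    alive-branch : ∀ y x → y ≡ y ℚ.+ (x ℚ.+ ℚ.- x ℚ.* ι 1)
    alive-branch = solve 2 (λ y x → y := y :+ (x :+ :- x :* con 1ℚ)) refl
      where open +-*-Solver

  Ex-attempts : ∀ m (g : Maybe A → ℚ) → g nothing ≡ 0ℚ →
    Ex (attempts (suc m) p) g ≡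
    Ex p g ℚ.+ (Ex (attempts m p) g ℚ.+ ℚ.- Ex (attempts m p) g ℚ.* success)
  Ex-attempts m g g0 = trans (Ex-bind p _) (trans (Ex-cong p pointwise) (Ex-retry g x))
    where
    x = Ex (attempts m p) g
    pointwise : ∀ r → Ex (orElse r (attempts m p)) g ≡ g r ℚ.+ (x ℚ.+ ℚ.- x ℚ.* ι (alive r))
    pointwise (just a) = alive-branch (g (just a)) x
    pointwise nothing rewrite g0 = trans (dead-branch x) (sym (ℚ.+-identityˡ _))

  meanCost-attempts : ∀ m → meanCost (attempts (suc m) p) ≡
    meanCost p ℚ.+ ((1ℚ ℚ.+ meanCost (attempts m p)) ℚ.+ ℚ.- (1ℚ ℚ.+ meanCost (attempts m p)) ℚ.* success)
  meanCost-attempts m = trans (meanCost-bind p _) (cong (λ y → meanCost p ℚ.+ y)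
    (trans (Ex-cong p pointwise) (trans (Ex-retry (λ _ → 0ℚ) x)
      (trans (cong (ℚ._+ (x ℚ.+ ℚ.- x ℚ.* success)) (Ex-const p 0ℚ)) (ℚ.+-identityˡ _)))))
    where
    x = 1ℚ ℚ.+ meanCost (attempts m p)
    pointwise : ∀ r → meanCost (orElse r (attempts m p)) ≡ 0ℚ ℚ.+ (x ℚ.+ ℚ.- x ℚ.* ι (alive r))
    pointwise (just a) = alive-branch 0ℚ x
    pointwise nothing = trans (dead-branch x) (sym (ℚ.+-identityˡ _))

  -- With c the mean cost of one attempt and σ its success probability, the truncated costs follow T
  -- ↦ c + (1 - σ)(1 + T), whose inner 1 pays for the restart. The assumption c + 1 ≤ σ B makes this
  -- map send B to at most B - σ, so B is never exceeded.
  ExpectedCost-bound : ∀ B → 0ℚ ℚ.≤ B → 0ℚ ℚ.≤ success →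
    meanCost p ℚ.+ 1ℚ ℚ.≤ success ℚ.* B → ExpectedCost≤ p B
  ExpectedCost-bound B 0≤B 0≤σ le zero = 0≤B
  ExpectedCost-bound B 0≤B 0≤σ le (suc m) = begin
    meanCost (attempts (suc m) p)
      ≡⟨ meanCost-attempts m ⟩
    c ℚ.+ ((1ℚ ℚ.+ T) ℚ.+ ℚ.- (1ℚ ℚ.+ T) ℚ.* success)
      ≡⟨ solve 3 (λ c T s → c :+ ((con 1ℚ :+ T) :+ :- (con 1ℚ :+ T) :* s)
                        := c :+ (con 1ℚ :+ :- s) :* (con 1ℚ :+ T)) refl c T success ⟩
    c ℚ.+ (1ℚ ℚ.+ ℚ.- success) ℚ.* (1ℚ ℚ.+ T)
      ≤⟨ ℚ.+-monoʳ-≤ c (ℚ.*-monoˡ-≤-nonNeg (1ℚ ℚ.+ ℚ.- success) {{ℚ.nonNegative fail≥0}}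
           (ℚ.+-monoʳ-≤ 1ℚ (ExpectedCost-bound B 0≤B 0≤σ le m))) ⟩
    c ℚ.+ (1ℚ ℚ.+ ℚ.- success) ℚ.* (1ℚ ℚ.+ B)
      ≡⟨ solve 3 (λ c B s → c :+ (con 1ℚ :+ :- s) :* (con 1ℚ :+ B)
                        := (c :+ con 1ℚ) :+ (B :+ :- (s :* B) :+ :- s)) refl c B success ⟩
    (c ℚ.+ 1ℚ) ℚ.+ (B ℚ.+ ℚ.- (success ℚ.* B) ℚ.+ ℚ.- success)
      ≤⟨ ℚ.+-monoˡ-≤ _ le ⟩
    success ℚ.* B ℚ.+ (B ℚ.+ ℚ.- (success ℚ.* B) ℚ.+ ℚ.- success)
      ≡⟨ solve 2 (λ B s → s :* B :+ (B :+ :- (s :* B) :+ :- s) := B :+ :- s) refl B success ⟩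
    B ℚ.+ ℚ.- success
      ≤⟨ ℚ.+-monoʳ-≤ B (ℚ.neg-antimono-≤ 0≤σ) ⟩
    B ℚ.+ 0ℚ
      ≡⟨ ℚ.+-identityʳ B ⟩
    B ∎
    where
    open ℚ.≤-Reasoning
    open +-*-Solver
    c = meanCost p
    T = meanCost (attempts m p)
    fail≥0 : 0ℚ ℚ.≤ 1ℚ ℚ.+ ℚ.- success
    fail≥0 = subst (ℚ._≤ 1ℚ ℚ.+ ℚ.- success) (ℚ.+-inverseʳ success) (ℚ.+-monoˡ-≤ (ℚ.- success) success≤1)

archimedean : ∀ r → 0ℚ ℚ.< r → ∃[ N ] 1ℚ ℚ.≤ ι N ℚ.* r
-- The denominator serves as N, the numerator being at least 1.
archimedean r@(mkℚ (+ suc n) d c) 0<r = suc d , ℚ.toℚᵘ-cancel-≤ (begin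
  ℚᵘ.1ℚᵘ                                   ≤⟨ ℚᵘ.*≤* le ⟩
  ℚᵘ.mkℚᵘ (+ suc d) 0 ℚᵘ.* ℚ.toℚᵘ r        ≃⟨ ℚᵘ.*-congʳ {ℚ.toℚᵘ r} (ℚ.toℚᵘ-fromℚᵘ (ℚᵘ.mkℚᵘ (+ suc d) 0)) ⟨
  ℚ.toℚᵘ (ι (suc d)) ℚᵘ.* ℚ.toℚᵘ r         ≃⟨ ℚ.toℚᵘ-homo-* (ι (suc d)) r ⟨
  ℚ.toℚᵘ (ι (suc d) ℚ.* r)                 ∎)
  where
  open ℚᵘ.≤-Reasoning
  le : 1ℤ ℤ.* + (1 * suc d) ℤ.≤ + suc d ℤ.* + suc n ℤ.* 1ℤ
  le = subst₂ ℤ._≤_ (trans (cong +_ (sym (ℕ.*-identityˡ (suc d)))) (sym (ℤ.*-identityˡ (+ (1 * suc d)))))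
    (trans (ℤ.pos-* (suc d) (suc n)) (sym (ℤ.*-identityʳ _)))
    (ℤ.+≤+ (ℕ.m≤m*n (suc d) (suc n)))
archimedean (mkℚ (+ zero) d c) 0<r with ℤ.+<+ () ← ℚ.drop-*<* 0<r
archimedean (mkℚ -[1+ n ] d c) 0<r with () ← ℚ.drop-*<* 0<r

-- The limit of a geometric series, with Bernoulli's inequality bounding the
-- error after m terms by 1 / (1 + m σ).
geometric-limit : ∀ {a : ℕ → ℚ} {q σ L} → a 0 ≡ 0ℚ →
  (∀ m → a (suc m) ≡ q ℚ.+ (a m ℚ.+ ℚ.- a m ℚ.* σ)) →
  0ℚ ℚ.< σ → σ ℚ.≤ 1ℚ → σ ℚ.* L ≡ q → 0ℚ ℚ.≤ L → L ℚ.≤ 1ℚ → a ⟶ L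
geometric-limit {a} {q} {σ} {L} a₀ step 0<σ σ≤1 σL≡q 0≤L L≤1 ε 0<ε = N , close
  where
  open +-*-Solver
  e : ℕ → ℚ
  e m = L ℚ.- a m
  instance
    _ : ℚ.Positive σ
    _ = ℚ.positive 0<σ
    _ : ℚ.NonNegative σ
    _ = ℚ.pos⇒nonNeg σ
    fail≥0 : ℚ.NonNegative (1ℚ ℚ.- σ)
    fail≥0 = ℚ.nonNegative (subst (ℚ._≤ 1ℚ ℚ.- σ) (ℚ.+-inverseʳ σ) (ℚ.+-monoˡ-≤ (ℚ.- σ) σ≤1))
  e-zero : e 0 ≡ L
  e-zero = trans (cong (λ x → L ℚ.- x) a₀) (ℚ.+-identityʳ L)
  e-suc : ∀ m → e (suc m) ≡ (1ℚ ℚ.- σ) ℚ.* e m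
  e-suc m = trans (cong (λ x → L ℚ.- x) (trans (step m) (cong (ℚ._+ (a m ℚ.+ ℚ.- a m ℚ.* σ)) (sym σL≡q))))
    (solve 3 (λ L σ a → L :+ :- (σ :* L :+ (a :+ :- a :* σ)) := (con 1ℚ :+ :- σ) :* (L :+ :- a)) refl L σ (a m))
  e≥0 : ∀ m → 0ℚ ℚ.≤ e m
  e≥0 zero    = subst (0ℚ ℚ.≤_) (sym e-zero) 0≤L
  e≥0 (suc m) = subst₂ ℚ._≤_ (ℚ.*-zeroʳ (1ℚ ℚ.- σ)) (sym (e-suc m))
    (ℚ.*-monoˡ-≤-nonNeg (1ℚ ℚ.- σ) (e≥0 m))
  bernoulli : ∀ m → e m ℚ.* (1ℚ ℚ.+ ι m ℚ.* σ) ℚ.≤ 1ℚ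
  bernoulli zero = subst (ℚ._≤ 1ℚ)
    (sym (trans (cong₂ ℚ._*_ e-zero (cong (λ x → 1ℚ ℚ.+ x) (ℚ.*-zeroˡ σ))) (ℚ.*-identityʳ L))) L≤1
  bernoulli (suc m) = begin
    e (suc m) ℚ.* (1ℚ ℚ.+ ι (suc m) ℚ.* σ)
      ≡⟨ cong₂ (λ x y → x ℚ.* (1ℚ ℚ.+ y ℚ.* σ)) (e-suc m) (ι-+ 1 m) ⟩
    (1ℚ ℚ.- σ) ℚ.* e m ℚ.* (1ℚ ℚ.+ (1ℚ ℚ.+ ι m) ℚ.* σ)
      ≡⟨ solve 3 (λ σ e m → (con 1ℚ :+ :- σ) :* e :* (con 1ℚ :+ (con 1ℚ :+ m) :* σ)
           := e :* (con 1ℚ :+ m :* σ) :+ :- (e :* (σ :* (σ :* (con 1ℚ :+ m))))) refl σ (e m) (ι m) ⟩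
    e m ℚ.* (1ℚ ℚ.+ ι m ℚ.* σ) ℚ.+ ℚ.- (e m ℚ.* (σ ℚ.* (σ ℚ.* (1ℚ ℚ.+ ι m))))
      ≤⟨ ℚ.+-mono-≤ (bernoulli m) (ℚ.neg-antimono-≤ defect≥0) ⟩
    1ℚ ℚ.+ 0ℚ ≡⟨ ℚ.+-identityʳ 1ℚ ⟩
    1ℚ ∎
    where
    open ℚ.≤-Reasoning
    0*≤ : ∀ {x y} → 0ℚ ℚ.≤ x → 0ℚ ℚ.≤ y → 0ℚ ℚ.≤ x ℚ.* y
    0*≤ {x} {y} 0≤x 0≤y = ℚ.nonNegative⁻¹ (x ℚ.* y)
      {{ℚ.nonNeg*nonNeg⇒nonNeg x {{ℚ.nonNegative 0≤x}} y {{ℚ.nonNegative 0≤y}}}}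
    defect≥0 : 0ℚ ℚ.≤ e m ℚ.* (σ ℚ.* (σ ℚ.* (1ℚ ℚ.+ ι m)))
    defect≥0 = 0*≤ (e≥0 m) (0*≤ (ℚ.<⇒≤ 0<σ) (0*≤ (ℚ.<⇒≤ 0<σ) (subst (0ℚ ℚ.≤_) (ι-+ 1 m) (0≤ι (suc m)))))
  0<σε : 0ℚ ℚ.< σ ℚ.* ε
  0<σε = ℚ.positive⁻¹ (σ ℚ.* ε) {{ℚ.pos*pos⇒pos σ ε {{ℚ.positive 0<ε}}}}
  N : ℕ
  N = proj₁ (archimedean (σ ℚ.* ε) 0<σε)
  small : ∀ m → N ≤ m → e m ℚ.< ε
  small m N≤m = ℚ.≰⇒> λ ε≤e → ℚ.<-irrefl refl (begin-strict
    1ℚ                                  ≤⟨ proj₂ (archimedean (σ ℚ.* ε) 0<σε) ⟩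
    ι N ℚ.* (σ ℚ.* ε)                   ≤⟨ ℚ.*-monoʳ-≤-nonNeg (σ ℚ.* ε) {{ℚ.nonNegative (ℚ.<⇒≤ 0<σε)}} (ι-mono N≤m) ⟩
    ι m ℚ.* (σ ℚ.* ε)                   ≤⟨ ℚ.*-monoˡ-≤-nonNeg (ι m) {{ℚ.nonNegative (0≤ι m)}} (ℚ.*-monoˡ-≤-nonNeg σ ε≤e) ⟩
    ι m ℚ.* (σ ℚ.* e m)                 ≡⟨ ℚ.+-identityˡ _ ⟨
    0ℚ ℚ.+ ι m ℚ.* (σ ℚ.* e m)          <⟨ ℚ.+-monoˡ-< (ι m ℚ.* (σ ℚ.* e m)) (ℚ.<-≤-trans 0<ε ε≤e) ⟩
    e m ℚ.+ ι m ℚ.* (σ ℚ.* e m)         ≡⟨ solve 3 (λ e m σ → e :+ m :* (σ :* e) := e :* (con 1ℚ :+ m :* σ)) refl (e m) (ι m) σ ⟩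
    e m ℚ.* (1ℚ ℚ.+ ι m ℚ.* σ)          ≤⟨ bernoulli m ⟩
    1ℚ ∎)
    where open ℚ.≤-Reasoning
  close : ∀ m → N ≤ m → ℚ.∣ a m ℚ.- L ∣ ℚ.< ε
  close m N≤m = subst (ℚ._< ε) (sym (begin
    ℚ.∣ a m ℚ.- L ∣         ≡⟨ cong ℚ.∣_∣ (solve 2 (λ a L → a :+ :- L := :- (L :+ :- a)) refl (a m) L) ⟩
    ℚ.∣ ℚ.- e m ∣           ≡⟨ ℚ.∣-p∣≡∣p∣ (e m) ⟩
    ℚ.∣ e m ∣               ≡⟨ ℚ.0≤p⇒∣p∣≡p (e≥0 m) ⟩
    e m                     ∎)) (small m N≤m)
    where open ≡-Reasoning

-- The algorithm

Ex-pass : ∀ k n (f : Maybe (Path k) → ℕ) →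
  Ex (motzkinAttempt k n) (ι ∘ f) ≡ weight k (suc n) ℚ.* ι (∑ (words k (suc n)) (f ∘ result ∘ outcome))
Ex-pass k n f = begin
  Ex (motzkinAttempt k n) (ι ∘ f)
    ≡⟨ Ex-bind (florentine {k} (suc n) [] 0ℤ) (fromPrefix n) ⟩
  Exᶠ {k} (suc n) initial (λ x → Ex (fromPrefix n x) (ι ∘ f))
    ≡⟨ Exᶠ-words {k} (suc n) ⟩
  weight k (suc n) ℚ.* ∑ᴿ W (λ R → Ex (fromPrefix n (state R)) (ι ∘ f))
    ≡⟨ cong (weight k (suc n) ℚ.*_) (∑ᴿ-cong-∈ W (λ {R} R∈ →
         Within-Ex (fromPrefix-outcome R (∈-words⁻ (suc n) R∈)) (ι ∘ f))) ⟩
  weight k (suc n) ℚ.* ∑ᴿ W (λ R → ι (f (result (outcome R))))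
    ≡⟨ cong (weight k (suc n) ℚ.*_) (∑-ι W {f ∘ result ∘ outcome}) ⟩
  weight k (suc n) ℚ.* ι (∑ W (f ∘ result ∘ outcome)) ∎
  where
  open ≡-Reasoning
  W = words k (suc n)

success-odd : ∀ k n → success (motzkinAttempt k n) ≡ weight k (suc n) ℚ.* ι (count k isOdd (suc n))
success-odd k n = trans (Ex-pass k n alive)
  (cong (λ x → weight k (suc n) ℚ.* ι x) (∑-cong (words k (suc n)) (λ R → pointwise (outcome R))))
  where
  pointwise : ∀ {R : Path k} (o : Outcome R) → alive (result o) ≡ atHeight isOdd (state R)
  pointwise (dead eq)              = sym (cong (atHeight isOdd) eq)
  pointwise (even i u)             = sym (trans (atHeight-Up isOdd u) (isOdd-even i))
  pointwise (odd i S T refl u v)   = sym (trans (atHeight-Up isOdd (join-Up u v)) (isEven-even i))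

-- The three terms are generation at six per living state, the parity test of every survivor, and Γ
-- with the shift for the odd ones.
pass-cost : ∀ k n → meanCost (motzkinAttempt k n) ℚ.≤ weight k (suc n) ℚ.*
  ι (6 * survived k (suc n) + (2 * count k one (suc n) + (n * 17 + 25) * count k isOdd (suc n)))
pass-cost k n = begin
  meanCost (motzkinAttempt k n)
    ≡⟨ meanCost-bind (florentine {k} (suc n) [] 0ℤ) (fromPrefix n) ⟩
  meanCost (florentine {k} (suc n) [] 0ℤ) ℚ.+ Exᶠ {k} (suc n) initial (λ x → meanCost (fromPrefix n x))
    ≤⟨ ℚ.+-mono-≤ generation processing ⟩
  w ℚ.* ι (6 * S) ℚ.+ w ℚ.* ι (2 * A + c * O)
    ≡⟨ ℚ.*-distribˡ-+ w (ι (6 * S)) (ι (2 * A + c * O)) ⟨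
  w ℚ.* (ι (6 * S) ℚ.+ ι (2 * A + c * O))
    ≡⟨ cong (w ℚ.*_) (ι-+ (6 * S) (2 * A + c * O)) ⟨
  w ℚ.* ι (6 * S + (2 * A + c * O)) ∎
  where
  open ℚ.≤-Reasoning
  w = weight k (suc n)
  S = survived k (suc n)
  A = count k one (suc n)
  O = count k isOdd (suc n)
  c = n * 17 + 25
  W = words k (suc n)
  generation : meanCost (florentine {k} (suc n) [] 0ℤ) ℚ.≤ w ℚ.* ι (6 * S)
  generation = begin
    meanCost (florentine {k} (suc n) [] 0ℤ)   ≤⟨ florentine-cost {k} (suc n) [] 0ℤ ⟩
    ι 6 ℚ.* lifetime {k} (suc n) initial        ≡⟨ cong (ι 6 ℚ.*_) (lifetime-survived k (suc n)) ⟩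
    ι 6 ℚ.* (w ℚ.* ι S)                       ≡⟨ solve 3 (λ a b c → a :* (b :* c) := b :* (a :* c)) refl (ι 6) w (ι S) ⟩
    w ℚ.* (ι 6 ℚ.* ι S)                       ≡⟨ cong (w ℚ.*_) (ι-* 6 S) ⟨
    w ℚ.* ι (6 * S)                           ∎
    where open +-*-Solver
  total : ∑ W (λ R → 2 * alive (state R) + c * atHeight isOdd (state R)) ≡ 2 * A + c * O
  total = trans (∑-∙ W) (cong₂ _+_
    (trans (∑-* W 2 {alive ∘ state}) (cong (2 *_) (survivors≡ k (suc n)))) (∑-* W c {atHeight isOdd ∘ state}))
  processing : Exᶠ {k} (suc n) initial (λ x → meanCost (fromPrefix n x)) ℚ.≤ w ℚ.* ι (2 * A + c * O)
  processing = begin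
    Exᶠ {k} (suc n) initial (λ x → meanCost (fromPrefix n x))
      ≡⟨ Exᶠ-words {k} (suc n) ⟩
    w ℚ.* ∑ᴿ W (λ R → meanCost (fromPrefix n (state R)))
      ≤⟨ ℚ.*-monoˡ-≤-nonNeg w {{ℚ.pos⇒nonNeg w {{weight-pos k (suc n)}}}} (∑ᴿ-mono W (λ {R} R∈ →
           Within-meanCost (fromPrefix-outcome R (∈-words⁻ (suc n) R∈)))) ⟩
    w ℚ.* ∑ᴿ W (λ R → ι (2 * alive (state R) + c * atHeight isOdd (state R)))
      ≡⟨ cong (w ℚ.*_) (trans (∑-ι W {λ R → 2 * alive (state R) + c * atHeight isOdd (state R)}) (cong ι total)) ⟩
    w ℚ.* ι (2 * A + c * O) ∎

-- Unfolded, `survived k n` is the sum of K^(n-j) A_j over j ≤ n; this is its term j = 0. It serves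
-- to show that survivors exist and to absorb the unit cost of a restart.
power≤survived : ∀ k n → (2 + k) ^ n ≤ survived k n
power≤survived k zero    = s≤s z≤n
power≤survived k (suc n) = ℕ.≤-trans (ℕ.*-monoʳ-≤ (2 + k) (power≤survived k n)) (ℕ.m≤m+n _ _)

survivors-pos : ∀ k → 1 ≤ k → ∀ n → 1 ≤ count k one n
survivors-pos k 1≤k n = ℕ.n≢0⇒n>0 λ A≡0 → ℕ.<-irrefl refl (begin-strict
  0                                       <⟨ ℕ.m^n>0 (2 + k) n ⟩
  (2 + k) ^ n                             ≤⟨ power≤survived k n ⟩
  survived k n                            ≤⟨ survived-bound k 1≤k n ⟩
  (2 + k) * (suc n * count k one n)       ≡⟨ cong (λ x → (2 + k) * (suc n * x)) A≡0 ⟩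
  (2 + k) * (suc n * 0)                   ≡⟨ cong ((2 + k) *_) (ℕ.*-zeroʳ (suc n)) ⟩
  (2 + k) * 0                             ≡⟨ ℕ.*-zeroʳ (2 + k) ⟩
  0                                       ∎)
  where open ℕ.≤-Reasoning

odd-pos : ∀ k → 1 ≤ k → ∀ n → 1 ≤ count k isOdd (suc n)
odd-pos k 1≤k n = ℕ.n≢0⇒n>0 λ O≡0 → contradiction
  (ℕ.≤-trans (survivors-pos k 1≤k n) (subst (λ x → count k one n ≤ 2 * x) O≡0 (survivors-odd k 1≤k n)))
  λ ()

success-pos : ∀ k → 1 ≤ k → ∀ n → 0ℚ ℚ.< success (motzkinAttempt k n)
success-pos k 1≤k n = subst (0ℚ ℚ.<_) (sym (success-odd k n))
  (ℚ.positive⁻¹ _ {{ℚ.pos*pos⇒pos (weight k (suc n)) {{weight-pos k (suc n)}} (ι O) {{ℚ.positive 0<ιO}}}})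
  where
  O = count k isOdd (suc n)
  0<ιO : 0ℚ ℚ.< ι O
  0<ιO = ℚ.<-≤-trans (ℚ.*<* (ℤ.+<+ (s≤s z≤n))) (ι-mono (odd-pos k 1≤k n))

-- The power is absorbed as a seventh copy of `survived`. With O the odd count, the two earlier
-- bounds give A ≤ 2 K O for the survivors and 7 · 2 K² (n + 2) O for the seven copies, where n + 2
-- ≤ 3 n yields 42 K². Doubling A gives 4 K, and 17 n + 25 ≤ 42 n the last 42.
pass-bound : ∀ k → 1 ≤ k → ∀ n → 1 ≤ n →
  6 * survived k (suc n) + (2 * count k one (suc n) + (n * 17 + 25) * count k isOdd (suc n)) + (2 + k) ^ suc n
  ≤ count k isOdd (suc n) * ((42 * ((2 + k) * (2 + k)) + 4 * (2 + k) + 42) * n)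
pass-bound k 1≤k (suc n) _ = begin
  6 * S + (2 * A′ + c * O) + K ^ suc (suc n)
    ≤⟨ ℕ.+-monoʳ-≤ (6 * S + (2 * A′ + c * O)) (power≤survived k (suc (suc n))) ⟩
  6 * S + (2 * A′ + c * O) + S
    ≡⟨ arith₁ S A′ (c * O) ⟩
  7 * S + 2 * A′ + c * O
    ≤⟨ ℕ.+-monoˡ-≤ (c * O) (ℕ.+-mono-≤ (ℕ.*-monoʳ-≤ 7 S≤) (ℕ.*-monoʳ-≤ 2 A′≤)) ⟩
  7 * (K * ((3 + n) * (K * (2 * O)))) + 2 * (K * (2 * O)) + c * O
    ≤⟨ ℕ.m≤m+n _ (28 * (K * K) * n * O + 4 * K * n * O + 25 * n * O) ⟩
  7 * (K * ((3 + n) * (K * (2 * O)))) + 2 * (K * (2 * O)) + c * O + (28 * (K * K) * n * O + 4 * K * n * O + 25 * n * O)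
    ≡⟨ arith₂ K n O ⟩
  O * ((42 * (K * K) + 4 * K + 42) * suc n) ∎
  where
  open ℕ.≤-Reasoning
  K = 2 + k
  S = survived k (suc (suc n))
  A′ = count k one (suc (suc n))
  O = count k isOdd (suc (suc n))
  c = suc n * 17 + 25
  A′≤ : A′ ≤ K * (2 * O)
  A′≤ = ℕ.≤-trans (ℕ.≤-trans (ℕ.m≤m+n A′ _) (ℕ.≤-reflexive (survivors-step k (suc n))))
    (ℕ.*-monoʳ-≤ K (survivors-odd k 1≤k (suc n)))
  S≤ : S ≤ K * ((3 + n) * (K * (2 * O)))
  S≤ = ℕ.≤-trans (survived-bound k 1≤k (suc (suc n))) (ℕ.*-monoʳ-≤ K (ℕ.*-monoʳ-≤ (3 + n) A′≤))
  arith₁ : ∀ S A x → 6 * S + (2 * A + x) + S ≡ 7 * S + 2 * A + x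
  arith₁ = solve-∀
  arith₂ : ∀ K n O → 7 * (K * ((3 + n) * (K * (2 * O)))) + 2 * (K * (2 * O)) + (suc n * 17 + 25) * O
    + (28 * (K * K) * n * O + 4 * K * n * O + 25 * n * O) ≡ O * ((42 * (K * K) + 4 * K + 42) * suc n)
  arith₂ = solve-∀

0≤reciprocal : ∀ n → 0ℚ ℚ.≤ reciprocal n
0≤reciprocal zero    = ℚ.≤-refl
0≤reciprocal (suc m) = ℚ.nonNegative⁻¹ (reciprocal (suc m)) {{ℚ.normalize-nonNeg 1 (suc m)}}

reciprocal≤1 : ∀ n → reciprocal n ℚ.≤ 1ℚ
reciprocal≤1 zero    = 0≤ι 1
reciprocal≤1 (suc m) = subst₂ ℚ._≤_ (ℚ.*-identityʳ (reciprocal (suc m))) (reciprocal-ι m)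
  (ℚ.*-monoˡ-≤-nonNeg (reciprocal (suc m)) {{ℚ.normalize-nonNeg 1 (suc m)}} (ι-mono {1} {suc m} (s≤s z≤n)))

uniformMass-bounds : ∀ k n w → 0ℚ ℚ.≤ uniformMass k n w × uniformMass k n w ℚ.≤ 1ℚ
uniformMass-bounds k n w with does (isMotzkin? w ×-dec (length w ℕ.≟ n))
... | true  = 0≤reciprocal (length (motzkinPaths k n)) , reciprocal≤1 (length (motzkinPaths k n))
... | false = ℚ.≤-refl , 0≤ι 1

-- The right side is the probability q that one pass outputs w. The claim that the limit is q / σ,
-- with σ the success probability, is stated without division, as `geometric-limit` expects it.
hits-uniform : ∀ k → 1 ≤ k → ∀ n w → success (motzkinAttempt k n) ℚ.* uniformMass k n w ≡
  weight k (suc n) ℚ.* ι (hits k n w)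
hits-uniform k 1≤k n w = cases (isMotzkin? w ×-dec (length w ℕ.≟ n))
  where
  open ≡-Reasoning
  open +-*-Solver
  w′ = weight k (suc n)
  L = length (motzkinPaths k n)
  -- A Motzkin path exists because an odd prefix does. This excludes the default value of
  -- `reciprocal` at zero.
  L>0 : 1 ≤ L
  L>0 = ℕ.n≢0⇒n>0 λ L≡0 → contradiction (odd-pos k 1≤k n) (ℕ.<⇒≱ (s≤s (ℕ.≤-reflexive
    (trans (odd-returns k n) (trans (cong (suc n *_) (trans (returns k n) L≡0)) (ℕ.*-zeroʳ (suc n)))))))
  cancel : ∀ L → 1 ≤ L → reciprocal L ℚ.* ι L ≡ 1ℚ
  cancel (suc m) _ = reciprocal-ι m
  cases : ∀ (d : Dec (IsMotzkin w × length w ≡ n)) → success (motzkinAttempt k n) ℚ.*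
    (if does d then reciprocal L else 0ℚ) ≡ w′ ℚ.* ι (hits k n w)
  cases (no ¬m) = trans (ℚ.*-zeroʳ (success (motzkinAttempt k n))) (sym (trans
    (cong (λ x → w′ ℚ.* ι x) (hits-other n {w} λ w∈ →
      let d , len = ∈-motzkinPaths⁻ {n = n} w∈ in ¬m (Down⇒IsMotzkin d , len)))
    (ℚ.*-zeroʳ w′)))
  cases (yes (m , len)) = begin
    success (motzkinAttempt k n) ℚ.* reciprocal L
      ≡⟨ cong (ℚ._* reciprocal L) (success-odd k n) ⟩
    w′ ℚ.* ι (count k isOdd (suc n)) ℚ.* reciprocal L
      ≡⟨ cong (λ x → w′ ℚ.* x ℚ.* reciprocal L)
           (trans (cong ι (trans (odd-returns k n) (cong (suc n *_) (returns k n)))) (ι-* (suc n) L)) ⟩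
    w′ ℚ.* (ι (suc n) ℚ.* ι L) ℚ.* reciprocal L
      ≡⟨ solve 4 (λ w a l r → w :* (a :* l) :* r := w :* a :* (r :* l)) refl w′ (ι (suc n)) (ι L) (reciprocal L) ⟩
    w′ ℚ.* ι (suc n) ℚ.* (reciprocal L ℚ.* ι L)
      ≡⟨ cong (w′ ℚ.* ι (suc n) ℚ.*_) (cancel L L>0) ⟩
    w′ ℚ.* ι (suc n) ℚ.* 1ℚ
      ≡⟨ ℚ.*-identityʳ _ ⟩
    w′ ℚ.* ι (suc n)
      ≡⟨ cong (λ x → w′ ℚ.* ι x) (subst (λ n → hits k n w ≡ suc n) len (hits-motzkin w (IsMotzkin⇒Down m))) ⟨
    w′ ℚ.* ι (hits k n w) ∎

output-uniform : ∀ k → 1 ≤ k → ∀ n → UniformMotzkinOutput k n (motzkinAttempt k n)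
output-uniform k 1≤k n w = geometric-limit {a = a} {q = weight k (suc n) ℚ.* ι (hits k n w)} refl step
  (success-pos k 1≤k n) (success≤1 p) (hits-uniform k 1≤k n w)
  (proj₁ (uniformMass-bounds k n w)) (proj₂ (uniformMass-bounds k n w))
  where
  open ≡-Reasoning
  p = motzkinAttempt k n
  hit : Maybe (Path k) → Bool
  hit r = does (r ≟ᴹ just w)
  a : ℕ → ℚ
  a m = Pr (attempts m p) hit
  f : Maybe (Path k) → ℕ
  f r = indicator (r ≟ᴹ just w)
  Pr≡ : ∀ (q : Prog k (Maybe (Path k))) → Pr q hit ≡ Ex q (ι ∘ f)
  Pr≡ q = trans (Pr-Ex q hit) (Ex-cong q (λ r → cast (hit r)))
    where
    cast : ∀ b → (if b then 1ℚ else 0ℚ) ≡ ι (if b then 1 else 0)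
    cast true  = refl
    cast false = refl
  step : ∀ m → a (suc m) ≡ weight k (suc n) ℚ.* ι (hits k n w) ℚ.+ (a m ℚ.+ ℚ.- a m ℚ.* success p)
  step m = begin
    a (suc m)
      ≡⟨ Pr≡ (attempts (suc m) p) ⟩
    Ex (attempts (suc m) p) (ι ∘ f)
      ≡⟨ Ex-attempts p m (ι ∘ f) refl ⟩
    Ex p (ι ∘ f) ℚ.+ (Ex (attempts m p) (ι ∘ f) ℚ.+ ℚ.- Ex (attempts m p) (ι ∘ f) ℚ.* success p)
      ≡⟨ cong₂ (λ x y → x ℚ.+ (y ℚ.+ ℚ.- y ℚ.* success p)) (Ex-pass k n f) (sym (Pr≡ (attempts m p))) ⟩
    weight k (suc n) ℚ.* ι (hits k n w) ℚ.+ (a m ℚ.+ ℚ.- a m ℚ.* success p) ∎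

mainTheorem2 : ∀ (k : ℕ) → 1 ≤ k →
    (∀ (n : ℕ) → 1 ≤ n → UniformMotzkinOutput k n (motzkinAttempt k n))
    × (∃ λ (C : ℕ) → (∀ (n : ℕ) → 1 ≤ n → ExpectedCost≤ (motzkinAttempt k n) (+ (C * n) / 1)))
mainTheorem2 k 1≤k = (λ n _ → output-uniform k 1≤k n) , C , λ n 1≤n →
  ExpectedCost-bound (motzkinAttempt k n) (ι (C * n)) (0≤ι (C * n)) (ℚ.<⇒≤ (success-pos k 1≤k n)) (bound n 1≤n)
  where
  C = 42 * ((2 + k) * (2 + k)) + 4 * (2 + k) + 42
  bound : ∀ n → 1 ≤ n → meanCost (motzkinAttempt k n) ℚ.+ 1ℚ ℚ.≤ success (motzkinAttempt k n) ℚ.* ι (C * n)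
  bound n 1≤n = begin
    meanCost (motzkinAttempt k n) ℚ.+ 1ℚ
      -- The 1 for the restart is written as K^-(n+1) · K^(n+1), so that the common weight factors
      -- out and an inequality in ℕ remains.
      ≤⟨ ℚ.+-mono-≤ (pass-cost k n) (ℚ.≤-reflexive (sym (weight-ι k (suc n)))) ⟩
    w ℚ.* ι T ℚ.+ w ℚ.* ι D
      ≡⟨ ℚ.*-distribˡ-+ w (ι T) (ι D) ⟨
    w ℚ.* (ι T ℚ.+ ι D)
      ≡⟨ cong (w ℚ.*_) (ι-+ T D) ⟨
    w ℚ.* ι (T + D)
      ≤⟨ ℚ.*-monoˡ-≤-nonNeg w {{ℚ.pos⇒nonNeg w {{weight-pos k (suc n)}}}} (ι-mono (pass-bound k 1≤k n 1≤n)) ⟩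
    w ℚ.* ι (O * (C * n))
      ≡⟨ cong (w ℚ.*_) (ι-* O (C * n)) ⟩
    w ℚ.* (ι O ℚ.* ι (C * n))
      ≡⟨ ℚ.*-assoc w (ι O) (ι (C * n)) ⟨
    w ℚ.* ι O ℚ.* ι (C * n)
      ≡⟨ cong (ℚ._* ι (C * n)) (success-odd k n) ⟨
    success (motzkinAttempt k n) ℚ.* ι (C * n) ∎
    where
    open ℚ.≤-Reasoning
    w = weight k (suc n)
    O = count k isOdd (suc n)
    D = (2 + k) ^ suc n
    T = 6 * survived k (suc n) + (2 * count k one (suc n) + (n * 17 + 25) * O)
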